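{- Let $d\ge 2$ and $c>1$ be fixed integers and let $C,\gamma>0$ be fixed real constants. There are constants $K$ and $A$, depending only on $d$, $c$, $C$ and $\gamma$, such that the following holds. Let $n\ge 4$ be such that $n/d$ is a power of two, let $U=\Sigma^c$ be a key universe, and let $X\subset U$ be a set of $m\le Cn$ keys (balls). Suppose the keys of $X$ are distributed into $d$ tables each consisting of $n/d$ bins according to the $d$-choice paradigm (with ties broken arbitrarily), using $d$ independent simple tabulation hash functions $h_1,\dots,h_d:U\to[n/d]$. Then with probability at least $1-A\,n^{ -\gamma}$ the maximum load of any bin is at most $K\log\log n$.
   Context: All logarithms are binary, and $[N]=\{0,1,\dots,N-1\}$. Simple tabulation: let $\Sigma$ be a finite alphabet and $c>1$ an integer. A key is a vector $x=(x[0],\dots,x[c-1])\in U=\Sigma^c$. Let $R=[2^r]$, identified with bit strings of length $r$, i.e. with $(\mathbb{Z}_2)^r$, with $\oplus$ denoting bitwise XOR. A simple tabulation hash function $h:U\to R$ is the random function $h(x)=\bigoplus_{i=0}^{c-1}h^{(i)}(x[i])$, where $h^{(0)},\dots,h^{(c-1)}:\Sigma\to R$ are independent and uniformly random functions. $d$-choice paradigm: there are $d$ disjoint groups (tables) $G_1,\dots,G_d$ of $n/d$ bins each; the bins of $G_i$ are $[n/d]\times\{i\}$. The keys of $X$ are inserted one at a time, in a given order. When key $x$ is inserted it is placed in one of the $d$ bins $(h_1(x),1),\dots,(h_d(x),d)$ having the currently smallest load (number of keys in the bin) among these $d$ bins; ties are broken arbitrarily. The maximum load is the largest number of keys in any bin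 after all $m$ keys have been inserted. -}

module Defs where

open import Data.Bool.Base using (Bool; true; false; T; _xor_)
import Data.Bool.Properties as Bool
open import Data.Fin.Base using (Fin)
import Data.Fin.Properties as Fin
open import Data.Integer.Base using (+_)
open import Data.List.Base
  using (List; []; _∷_; length; map; filter; filterᵇ; allFin; cartesianProduct; cartesianProductWith)
open import Data.List.Extrema.Nat using (max)
open import Data.List.Properties using (length-++; length-map)
open import Data.Nat.Base as ℕ using (ℕ; zero; suc; NonZero)
import Data.Nat.Properties as ℕ
open import Data.Product.Base using (∃; ∃-syntax; _×_; _,_)
import Data.Product.Properties as Product
open import Data.Rational.Base
  using (ℚ; 0ℚ; 1ℚ; _/_; _≤_; _<_; _*_; _-_; +-*-rawSemiring)
open import Algebra.Definitions.RawSemiring +-*-rawSemiring using (_^_)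
open import Data.Sum.Base using (_⊎_)
open import Data.Vec.Base as Vec using (Vec; []; _∷_; zipWith; lookup; replicate)
import Data.Vec.Properties as Vec
open import Relation.Binary.Definitions using (DecidableEquality)
open import Relation.Binary.PropositionalEquality using (_≡_; refl; sym; trans; cong; cong₂; subst)
open import Relation.Nullary using (¬_)

------------------------------------------------------------------------
-- Real numbers

-- Dedekind reals.
record ℝ : Set₁ where
  field
    Below : ℚ → Set      -- Below q : q is less than the real
    Above : ℚ → Set      -- Above q : q is greater than the real
    below-inhabited : ∃ Below
    above-inhabited : ∃ Above
    below-lower : ∀ {p q} → p < q → Below q → Below p
    below-open  : ∀ {p} → Below p → ∃[ q ] p < q × Below q
    above-upper : ∀ {p q} → p < q → Above p → Above q
    above-open  : ∀ {q} → Above q → ∃[ p ] p < q × Above p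
    disjoint    : ∀ {q} → ¬ (Below q × Above q)
    located     : ∀ {p q} → p < q → Below p ⊎ Above q

Positive : ℝ → Set
Positive x = ℝ.Below x 0ℚ

fromℕ : ℕ → ℚ
fromℕ k = + k / 1

-- A real expression e is represented by the set of rationals q with e < q,
-- which determines e.  Upper bounds by e need nothing more.
UpperCut : Set₁
UpperCut = ℚ → Set

upper : ℝ → UpperCut
upper = ℝ.Above

natural : ℕ → UpperCut
natural k q = fromℕ k < q

infix  4 _≤ᵘ_
infixr 7 _·_

_≤ᵘ_ : ℚ → UpperCut → Set
p ≤ᵘ e = ∀ q → e q → p ≤ q

_·_ : ℕ → UpperCut → UpperCut
(k · e) q = ∃[ p ] e p × fromℕ k * p < q

-- Binary logarithm of a real e ≥ 1:  log₂ e < t  iff  e < y ≤ 2 ^ (a / b)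
-- for some rationals y and 0 ≤ a / b ≤ t; here y ≤ 2 ^ (a / b) is written
-- y ^ b ≤ 2 ^ a, with b = suc b′.
log₂ : UpperCut → UpperCut
log₂ e t = ∃[ y ] e y ×
  ∃[ a ] ∃[ b′ ] + a / suc b′ ≤ t × y ^ suc b′ ≤ fromℕ 2 ^ a

-- n to the power -γ, for n ≥ 1 and γ > 0:  n ^ (-γ) < q  iff
-- n ^ (-(a / b)) < q for some rational 0 ≤ a / b < γ; for q > 0 the
-- inequality is 1 < q ^ b * n ^ a, with b = suc b′.
_^-_ : ℕ → ℝ → UpperCut
(n ^- γ) q = 0ℚ < q ×
  ∃[ a ] ∃[ b′ ] ℝ.Below γ (+ a / suc b′) × 1ℚ < q ^ suc b′ * fromℕ n ^ a

------------------------------------------------------------------------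
-- Simple tabulation hashing

-- The alphabet Σ is Fin s.
Key : (c s : ℕ) → Set
Key c s = Vec (Fin s) c

-- The range [2 ^ r], as bit strings.
Bits : ℕ → Set
Bits r = Vec Bool r

_⊕_ : ∀ {r} → Bits r → Bits r → Bits r
_⊕_ = zipWith _xor_

-- The character functions h⁽⁰⁾ , … , h⁽ᶜ⁻¹⁾ : Σ → [2 ^ r], as value tables.
Tabulation : (c s r : ℕ) → Set
Tabulation c s r = Vec (Vec (Bits r) s) c

hash : ∀ {c s r} → Tabulation c s r → Key c s → Bits r
hash {r = r} h x = Vec.foldr′ _⊕_ (replicate r false) (zipWith lookup h x)

-- The sample space: one tabulation for each of h₁ , … , h_d.
Tabulations : (d c s r : ℕ) → Set
Tabulations d c s r = Vec (Tabulation c s r) d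

------------------------------------------------------------------------
-- The d-choice paradigm

Bin : (d r : ℕ) → Set
Bin d r = Bits r × Fin d

_≟_ : ∀ {d r} → DecidableEquality (Bin d r)
_≟_ = Product.≡-dec (Vec.≡-dec Bool._≟_) Fin._≟_

bin : ∀ {d c s r} → Tabulations d c s r → Key c s → Fin d → Bin d r
bin H x i = hash (lookup H i) x , i

-- A placement lists the bins that received the keys inserted so far.
load : ∀ {d r} → List (Bin d r) → Bin d r → ℕ
load bs b = length (filter (b ≟_) bs)

-- Allocation H xs bs : the d-choice paradigm with hash functions H can place
-- the keys xs in the bins bs, for some way of breaking ties.  Both lists have
-- the most recently inserted key first.
data Allocation {d c s r} (H : Tabulations d c s r) :
     List (Key c s) → List (Bin d r) → Set where
  empty  : Allocation H [] []
  insert : ∀ {x xs bs} → Allocation H xs bs →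
           (i : Fin d) →
           (∀ j → load bs (bin H x i) ℕ.≤ load bs (bin H x j)) →
           Allocation H (x ∷ xs) (bin H x i ∷ bs)

------------------------------------------------------------------------
-- Enumerations

vectors : {A : Set} → List A → (k : ℕ) → List (Vec A k)
vectors as zero    = [] ∷ []
vectors as (suc k) = cartesianProductWith _∷_ as (vectors as k)

allBits : (r : ℕ) → List (Bits r)
allBits = vectors (false ∷ true ∷ [])

allTabulations : (d c s r : ℕ) → List (Tabulations d c s r)
allTabulations d c s r = vectors (vectors (vectors (allBits r) s) c) d

allBins : (d r : ℕ) → List (Bin d r)
allBins d r = cartesianProduct (allBits r) (allFin d)

maxLoad : ∀ {d r} → List (Bin d r) → ℕ
maxLoad {d} {r} bs = max 0 (map (load bs) (allBins d r))

length-cartesianProductWith :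
  {A B C : Set} (f : A → B → C) (as : List A) (bs : List B) →
  length (cartesianProductWith f as bs) ≡ length as ℕ.* length bs
length-cartesianProductWith f []       bs = refl
length-cartesianProductWith f (a ∷ as) bs =
  trans (length-++ (map (f a) bs))
        (cong₂ ℕ._+_ (length-map (f a) bs) (length-cartesianProductWith f as bs))

length-vectors : {A : Set} (as : List A) (k : ℕ) →
                 length (vectors as k) ≡ length as ℕ.^ k
length-vectors as zero    = refl
length-vectors as (suc k) =
  trans (length-cartesianProductWith _∷_ as (vectors as k))
        (cong (length as ℕ.*_) (length-vectors as k))

vectors-nonZero : {A : Set} (as : List A) (k : ℕ) →
                  NonZero (length as) → NonZero (length (vectors as k))
vectors-nonZero as k as≢[] =
  subst NonZero (sym (length-vectors as k)) (ℕ.m^n≢0 (length as) k {{as≢[]}})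

allTabulations-nonZero : ∀ d c s r → NonZero (length (allTabulations d c s r))
allTabulations-nonZero d c s r =
  vectors-nonZero _ d (vectors-nonZero _ c (vectors-nonZero _ s
    (vectors-nonZero (false ∷ true ∷ []) r _)))

------------------------------------------------------------------------
-- Probability

-- All character functions of all h₁ , … , h_d are independent and uniform,
-- so the sample space carries the uniform distribution.
ℙ : ∀ {d c s r} → (Tabulations d c s r → Bool) → ℚ
ℙ {d} {c} {s} {r} S =
  _/_ (+ length (filterᵇ S (allTabulations d c s r)))
      (length (allTabulations d c s r))
      {{allTabulations-nonZero d c s r}}

-- E has probability at least 1 - δ.  An event that compares real numbers need
-- not be decidable, so its probability is taken to be the inner one: the
-- largest probability of a decidable event contained in E.  Classically
-- every event of a finite space is decidable and this is the usual notion.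
-- 1 - δ is the supremum of 1 - q over the rationals q > δ.
WithProbability≥1-_∶_ : ∀ {d c s r} → UpperCut → (Tabulations d c s r → Set) → Set
WithProbability≥1- δ ∶ E =
  ∃[ S ] (∀ H → T (S H) → E H) × (∀ q → δ q → 1ℚ - q ≤ ℙ S)

{-# OPTIONS --safe #-}
module Submission where

-- Only the first two tables matter.  Every key is an edge between its two hash
-- values there, and a bin of load (j + 1) L has L edges whose other ends had load
-- at least j L, so a load of order log log n makes a tree with more than log n
-- inner nodes hang from some bin.
--
-- A list of collisions h(x) = h(y), each involving a table entry, its pivot, that
-- occurs once in it and in no earlier collision of the same h, has probability at
-- most R ^ -(length), by resampling the pivots one after the other; R = 2 ^ r.
-- Call a position character light if at most R ^ (1 - 1/2c) keys contain it.
-- Outside an event of probability O(n ^ -γ), only O(1) of the keys with a given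
-- light character, and only O(1) of the keys without light characters, share a
-- hash value.  Hence a vertex of the tree, reached through the edge z, either has
-- M edges with new and pairwise different light characters, whose collisions with
-- z have pivots in these edges; or one of its edges x shares a light character
-- with an earlier edge but not with z, and the collision has its pivot in z.  There
-- are at most m ^ M / M ! ≤ R ^ M / 4 choices of the M edges, and O(r R ^ (1 - 1/2c))
-- choices of x.  In the second case the vertex is given up, as are the at most c
-- unexplored edges that share a light character with x.  So the probability of
-- exploring Θ(log n) vertices, or of giving up vertices Θ(c γ) times, is O(n ^ -γ).

open import Defs
open import Algebra.Bundles using (CommutativeMonoid)
open import Data.Bool.Base using (Bool; true; false; not; T; if_then_else_; _xor_)
import Data.Bool.Properties as Bool
open import Data.Bool.Properties using (T?)
open import Data.Empty using (⊥-elim)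
open import Data.Fin.Base using (Fin; zero; suc)
import Data.Fin.Properties as Fin
import Data.Integer.Base as ℤ
import Data.Integer.Properties as ℤ
open import Data.List.Base
  using (List; []; _∷_; length; map; _++_; filter; filterᵇ; allFin; concatMap; cartesianProductWith)
open import Data.List.Extrema.Nat using (max≤v⁺)
open import Data.List.Membership.Propositional using (_∈_; find; lose)
open import Data.List.Membership.Propositional.Properties
  using (∈-++⁺ˡ; ∈-++⁺ʳ; ∈-++⁻; ∈-map⁺; ∈-map⁻; ∈-filter⁺; ∈-filter⁻; ∈-allFin; ∈-concatMap⁺; ∈-cartesianProductWith⁺)
import Data.List.Properties as List
open import Data.List.Properties using (length-++; length-map; filter-reject)
open import Data.List.Relation.Binary.Sublist.Propositional
  using (_⊆_; []; _∷_; _∷ʳ_; ⊆-refl; ⊆-trans; minimum)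
open import Data.List.Relation.Binary.Sublist.Propositional.Properties
  using (All-resp-⊆; Any-resp-⊆; filter-⊆; length-mono-≤)
open import Data.List.Relation.Unary.All as All using (All; []; _∷_)
import Data.List.Relation.Unary.All.Properties as All
open import Data.List.Relation.Unary.AllPairs as AllPairs using (AllPairs; []; _∷_)
import Data.List.Relation.Unary.AllPairs.Properties as AllPairs
open import Data.List.Relation.Unary.Any using (Any; here; there; any?)
open import Data.List.Relation.Unary.Unique.Propositional using (Unique)
import Data.List.Relation.Unary.Unique.Propositional.Properties as Unique
open import Data.Nat.Base as ℕ
open import Data.Nat.DivMod using (m≡m%n+[m/n]*n; m%n<n; m/n*n≤m)
import Data.Nat.Properties as ℕ
open import Data.Nat.Properties hiding (_≟_)
open import Data.Nat.Tactic.RingSolver using (solve-∀)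
open import Data.Product.Base using (_×_; _,_; proj₁; proj₂; ∃; ∃-syntax; Σ-syntax)
open import Data.Rational.Base as ℚ using (ℚ; 0ℚ; 1ℚ; toℚᵘ)
import Data.Rational.Properties as ℚ
open import Data.Rational.Unnormalised.Base as ℚᵘ using (mkℚᵘ; *≡*; *≤*)
import Data.Rational.Unnormalised.Properties as ℚᵘ
open import Data.Sum.Base using (_⊎_; inj₁; inj₂)
open import Data.Unit.Base using (tt)
open import Data.Vec.Base as Vec using (Vec; []; _∷_; lookup; updateAt; zipWith; replicate; toList)
import Data.Vec.Properties as Vec
open import Algebra.Definitions.RawSemiring ℚ.+-*-rawSemiring using () renaming (_^_ to _^ℚ_)
open import Algebra.Properties.CommutativeSemigroup *-commutativeSemigroup using (x∙yz≈y∙xz; xy∙z≈xz∙y)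
open import Function.Base using (_∘_)
open import Relation.Binary.Definitions using (DecidableEquality; tri<; tri≈; tri>)
open import Relation.Binary.PropositionalEquality
open import Relation.Nullary using (¬_; Dec; yes; no; does; ¬?; _×-dec_)
open import Relation.Nullary.Decidable using (map′)
open import Relation.Unary using (Decidable)

-- A pivot has to be an entry that the constraints made so far leave undetermined. The end of an
-- edge still to be explored lies in the other table than the one through which the edge was found.
-- The two kinds of steps differ in how much they gain. An edge has about as many choices as there
-- are hash values, so in a good step the choices outweigh the collisions up to a constant, and only
-- the `M !` of unordered choices turns this into a constant gain; order of log n such steps are
-- needed. The edges of bad steps share light characters with few known keys, so each bad step gains
-- a fixed power of R and constantly many suffice. A bad step may give up any pending edges, with
-- everything still to be explored below them. The branching number M exceeds the total possible
-- loss by two, so a binary tree survives whichever edges are lost.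

private variable
  A B : Set

-- Sums and counting

∑ : List A → (A → ℕ) → ℕ
∑ []       f = 0
∑ (x ∷ xs) f = f x + ∑ xs f

∑-mono : ∀ (xs : List A) {f g} → (∀ x → f x ≤ g x) → ∑ xs f ≤ ∑ xs g
∑-mono []       f≤g = z≤n
∑-mono (x ∷ xs) f≤g = +-mono-≤ (f≤g x) (∑-mono xs f≤g)

∑-cong : ∀ (xs : List A) {f g} → (∀ x → f x ≡ g x) → ∑ xs f ≡ ∑ xs g
∑-cong []       f≡g = refl
∑-cong (x ∷ xs) f≡g = cong₂ _+_ (f≡g x) (∑-cong xs f≡g)

∑-++ : ∀ (xs ys : List A) f → ∑ (xs ++ ys) f ≡ ∑ xs f + ∑ ys f
∑-++ []       ys f = refl
∑-++ (x ∷ xs) ys f = trans (cong (f x +_) (∑-++ xs ys f)) (sym (+-assoc (f x) _ _))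

∑-map : ∀ (h : A → B) xs f → ∑ (map h xs) f ≡ ∑ xs (f ∘ h)
∑-map h []       f = refl
∑-map h (x ∷ xs) f = cong (f (h x) +_) (∑-map h xs f)

∑-distrib-+ : ∀ (xs : List A) f g → ∑ xs (λ x → f x + g x) ≡ ∑ xs f + ∑ xs g
∑-distrib-+ []       f g = refl
∑-distrib-+ (x ∷ xs) f g rewrite ∑-distrib-+ xs f g = interchange (f x) (g x) _ _
  where
  interchange : ∀ a b c d → (a + b) + (c + d) ≡ (a + c) + (b + d)
  interchange = solve-∀

∑-zero : ∀ (xs : List A) → ∑ xs (λ _ → 0) ≡ 0
∑-zero []       = refl
∑-zero (x ∷ xs) = ∑-zero xs

∑-swap : ∀ (xs : List A) (ys : List B) (f : A → B → ℕ) →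
         ∑ xs (λ x → ∑ ys (f x)) ≡ ∑ ys (λ y → ∑ xs (λ x → f x y))
∑-swap []       ys f = sym (∑-zero ys)
∑-swap (x ∷ xs) ys f =
  trans (cong (∑ ys (f x) +_) (∑-swap xs ys f)) (sym (∑-distrib-+ ys (f x) _))

∑-*ʳ : ∀ (xs : List A) f k → ∑ xs f * k ≡ ∑ xs (λ x → f x * k)
∑-*ʳ []       f k = refl
∑-*ʳ (x ∷ xs) f k = trans (*-distribʳ-+ k (f x) _) (cong (f x * k +_) (∑-*ʳ xs f k))

∑-≤-length* : ∀ (xs : List A) {f} k → All (λ x → f x ≤ k) xs → ∑ xs f ≤ length xs * k
∑-≤-length* []       k []       = z≤n
∑-≤-length* (x ∷ xs) k (p ∷ ps) = +-mono-≤ p (∑-≤-length* xs k ps)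

∑-const : ∀ (xs : List A) k → ∑ xs (λ _ → k) ≡ length xs * k
∑-const []       k = refl
∑-const (x ∷ xs) k = cong (k +_) (∑-const xs k)

∑-∈ : ∀ {xs : List A} {x} (f : A → ℕ) → x ∈ xs → f x ≤ ∑ xs f
∑-∈ f (here refl) = m≤m+n _ _
∑-∈ f (there x∈)  = ≤-trans (∑-∈ f x∈) (m≤n+m _ _)

∑-cartesianProductWith : ∀ {C : Set} (h : A → B → C) as bs f →
  ∑ (cartesianProductWith h as bs) f ≡ ∑ as (λ a → ∑ bs (λ b → f (h a b)))
∑-cartesianProductWith h []       bs f = refl
∑-cartesianProductWith h (a ∷ as) bs f =
  trans (∑-++ (map (h a) bs) _ f)
        (cong₂ _+_ (∑-map (h a) bs f) (∑-cartesianProductWith h as bs f))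

ind : {P : Set} → Dec P → ℕ
ind P? = if does P? then 1 else 0

ind-yes : {P : Set} (P? : Dec P) → P → ind P? ≡ 1
ind-yes (yes _) p = refl
ind-yes (no ¬p) p = ⊥-elim (¬p p)

ind-no : {P : Set} (P? : Dec P) → ¬ P → ind P? ≡ 0
ind-no (yes p) ¬p = ⊥-elim (¬p p)
ind-no (no _)  ¬p = refl

ind≤1 : {P : Set} (P? : Dec P) → ind P? ≤ 1
ind≤1 (yes _) = ≤-refl
ind≤1 (no _)  = z≤n

ind-≤ : {P : Set} (P? : Dec P) {k : ℕ} → (P → 1 ≤ k) → ind P? ≤ k
ind-≤ (yes p) h = h p
ind-≤ (no _)  h = z≤n

ind-mono : {P Q : Set} (P? : Dec P) (Q? : Dec Q) → (P → Q) → ind P? ≤ ind Q?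
ind-mono P? Q? P⇒Q = ind-≤ P? λ p → ≤-reflexive (sym (ind-yes Q? (P⇒Q p)))

count : {P : A → Set} → Decidable P → List A → ℕ
count P? xs = ∑ xs (λ x → ind (P? x))

length-filter≡count : ∀ {P : A → Set} (P? : Decidable P) xs → length (filter P? xs) ≡ count P? xs
length-filter≡count P? []       = refl
length-filter≡count P? (x ∷ xs) with does (P? x)
... | true  = cong suc (length-filter≡count P? xs)
... | false = length-filter≡count P? xs

count-mono : ∀ {P Q : A → Set} (P? : Decidable P) (Q? : Decidable Q) →
             (∀ x → P x → Q x) → ∀ xs → count P? xs ≤ count Q? xs
count-mono P? Q? P⇒Q xs = ∑-mono xs λ x → ind-mono (P? x) (Q? x) (P⇒Q x)

count≤length : ∀ {P : A → Set} (P? : Decidable P) xs → count P? xs ≤ length xs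
count≤length P? xs = ≤-trans (∑-≤-length* xs 1 (All.tabulate λ {x} _ → ind≤1 (P? x)))
                             (≤-reflexive (*-identityʳ _))

count-some : ∀ {P : A → Set} (P? : Decidable P) {xs x} → x ∈ xs → P x → 1 ≤ count P? xs
count-some P? {x = x} x∈xs px =
  ≤-trans (≤-reflexive (sym (ind-yes (P? x) px))) (∑-∈ (λ y → ind (P? y)) x∈xs)

count-none : ∀ {P : A → Set} (P? : Decidable P) xs → All (λ x → ¬ P x) xs → count P? xs ≡ 0
count-none P? []       []         = refl
count-none P? (x ∷ xs) (¬p ∷ ¬ps) = cong₂ _+_ (ind-no (P? x) ¬p) (count-none P? xs ¬ps)

count-unique≤1 : ∀ {P : A → Set} (P? : Decidable P) {xs} → Unique xs →
                 (∀ {x y} → P x → P y → x ≡ y) → count P? xs ≤ 1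
count-unique≤1 P? []            P! = z≤n
count-unique≤1 P? {x ∷ xs} (x∉ ∷ xs!) P! with P? x
... | no _  = count-unique≤1 P? xs! P!
... | yes p = ≤-reflexive (cong suc (count-none P? xs (All.map (λ x≢y q → x≢y (P! p q)) x∉)))

count-≤ind : ∀ {P : A → Set} {Q : Set} (P? : Decidable P) (Q? : Dec Q) {xs} → Unique xs →
             (∀ {x} → P x → Q) → (∀ {x y} → P x → P y → x ≡ y) → count P? xs ≤ ind Q?
count-≤ind P? (yes _) xs! _   P! = count-unique≤1 P? xs! P!
count-≤ind P? (no ¬q) {xs} xs! P⇒Q _  = ≤-reflexive (count-none P? xs (All.tabulate λ _ → ¬q ∘ P⇒Q))

-- Resampling one entry of the value tables

-- Measure preservation, expressed through sums instead of a permutation of the list, so that it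
-- passes to `vectors` one coordinate at a time.
Invariant : List A → (A → A) → Set
Invariant as π = ∀ f → ∑ as (f ∘ π) ≡ ∑ as f

vectors-invariant : ∀ {as : List A} {π k} → Invariant as π → (i : Fin k) →
                    Invariant (vectors as k) (λ v → updateAt v i π)
vectors-invariant {as = as} {k = suc k} inv zero f = begin
  ∑ (vectors as (suc k)) (λ v → f (updateAt v zero _))  ≡⟨ ∑-cartesianProductWith _∷_ as (vectors as k) _ ⟩
  ∑ as (λ a → ∑ (vectors as k) (λ v → f (_ ∷ v)))       ≡⟨ inv (λ a → ∑ (vectors as k) (λ v → f (a ∷ v))) ⟩
  ∑ as (λ a → ∑ (vectors as k) (λ v → f (a ∷ v)))       ≡⟨ ∑-cartesianProductWith _∷_ as (vectors as k) f ⟨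
  ∑ (vectors as (suc k)) f                              ∎
  where open ≡-Reasoning
vectors-invariant {as = as} {k = suc k} inv (suc i) f = begin
  ∑ (vectors as (suc k)) (λ v → f (updateAt v (suc i) _))          ≡⟨ ∑-cartesianProductWith _∷_ as (vectors as k) _ ⟩
  ∑ as (λ a → ∑ (vectors as k) (λ v → f (a ∷ updateAt v i _)))     ≡⟨ ∑-cong as (λ a → vectors-invariant inv i (λ v → f (a ∷ v))) ⟩
  ∑ as (λ a → ∑ (vectors as k) (λ v → f (a ∷ v)))                  ≡⟨ ∑-cartesianProductWith _∷_ as (vectors as k) f ⟨
  ∑ (vectors as (suc k)) f                                         ∎
  where open ≡-Reasoning

xor-invariant : ∀ b → Invariant (false ∷ true ∷ []) (b xor_)
xor-invariant false f = refl
xor-invariant true  f = swap (f true) (f false)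
  where
  swap : ∀ a b → a + (b + 0) ≡ b + (a + 0)
  swap = solve-∀

⊕-invariant : ∀ {r} (b : Bits r) → Invariant (allBits r) (b ⊕_)
⊕-invariant []                f = refl
⊕-invariant {suc r} (b₀ ∷ b) f = begin
  ∑ (allBits (suc r)) (λ v → f ((b₀ ∷ b) ⊕ v))
    ≡⟨ ∑-cartesianProductWith _∷_ (false ∷ true ∷ []) (allBits r) _ ⟩
  ∑ (false ∷ true ∷ []) (λ a → ∑ (allBits r) (λ v → f ((b₀ xor a) ∷ (b ⊕ v))))
    ≡⟨ ∑-cong (false ∷ true ∷ []) (λ a → ⊕-invariant b (λ v → f ((b₀ xor a) ∷ v))) ⟩
  ∑ (false ∷ true ∷ []) (λ a → ∑ (allBits r) (λ v → f ((b₀ xor a) ∷ v)))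
    ≡⟨ xor-invariant b₀ (λ a → ∑ (allBits r) (λ v → f (a ∷ v))) ⟩
  ∑ (false ∷ true ∷ []) (λ a → ∑ (allBits r) (λ v → f (a ∷ v)))
    ≡⟨ ∑-cartesianProductWith _∷_ (false ∷ true ∷ []) (allBits r) f ⟨
  ∑ (allBits (suc r)) f ∎
  where open ≡-Reasoning

⊕-comm : ∀ {r} (a b : Bits r) → a ⊕ b ≡ b ⊕ a
⊕-comm = Vec.zipWith-comm Bool.xor-comm

⊕-assoc : ∀ {r} (a b c : Bits r) → (a ⊕ b) ⊕ c ≡ a ⊕ (b ⊕ c)
⊕-assoc = Vec.zipWith-assoc Bool.xor-assoc

⊕-self : ∀ {r} (a : Bits r) → a ⊕ a ≡ replicate r false
⊕-self []      = refl
⊕-self (a ∷ v) = cong₂ _∷_ (Bool.xor-same a) (⊕-self v)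

⊕-identityʳ : ∀ {r} (a : Bits r) → a ⊕ replicate r false ≡ a
⊕-identityʳ = Vec.zipWith-identityʳ Bool.xor-identityʳ

⊕-cancelʳ : ∀ {r} (a b c : Bits r) → a ⊕ c ≡ b ⊕ c → a ≡ b
⊕-cancelʳ {r} a b c eq = trans (sym (undo a)) (trans (cong (_⊕ c) eq) (undo b))
  where
  undo : ∀ a → (a ⊕ c) ⊕ c ≡ a
  undo a = trans (⊕-assoc a c c) (trans (cong (a ⊕_) (⊕-self c)) (⊕-identityʳ a))

⊕-left-comm : ∀ {r} (a b c : Bits r) → a ⊕ (b ⊕ c) ≡ b ⊕ (a ⊕ c)
⊕-left-comm a b c = trans (sym (⊕-assoc a b c)) (trans (cong (_⊕ c) (⊕-comm a b)) (⊕-assoc b a c))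

hash-resample : ∀ {c s r} (h : Tabulation c s r) p b (x : Key c s) →
  hash (updateAt h p (λ v → updateAt v (lookup x p) (b ⊕_))) x ≡ b ⊕ hash h x
hash-resample (v ∷ h) zero    b (t ∷ x) =
  trans (cong (_⊕ hash h x) (Vec.lookup∘updateAt t v)) (⊕-assoc b (lookup v t) (hash h x))
hash-resample (v ∷ h) (suc p) b (t ∷ x) =
  trans (cong (lookup v t ⊕_) (hash-resample h p b x)) (⊕-left-comm (lookup v t) b (hash h x))

hash-resample-other : ∀ {c s r} (h : Tabulation c s r) p {t} b (x : Key c s) → lookup x p ≢ t →
  hash (updateAt h p (λ v → updateAt v t (b ⊕_))) x ≡ hash h x
hash-resample-other (v ∷ h) zero {t} b (u ∷ x) u≢t =
  cong (_⊕ hash h x) (Vec.lookup∘updateAt′ u t u≢t v)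
hash-resample-other (v ∷ h) (suc p) b (u ∷ x) ≢t =
  cong (lookup v u ⊕_) (hash-resample-other h p b x ≢t)

vectors-unique : ∀ {as : List A} → Unique as → ∀ k → Unique (vectors as k)
vectors-unique as! zero    = [] ∷ []
vectors-unique as! (suc k) = Unique.cartesianProductWith⁺ _∷_ Vec.∷-injective as! (vectors-unique as! k)

allBits-unique : ∀ r → Unique (allBits r)
allBits-unique = vectors-unique (((λ ()) ∷ []) ∷ [] ∷ [])

_≟ᵇ_ : ∀ {r} (u v : Bits r) → Dec (u ≡ v)
_≟ᵇ_ = Vec.≡-dec Bool._≟_

length-allBits : ∀ r → length (allBits r) ≡ 2 ^ r
length-allBits = length-vectors _

-- Systems of collision constraints

module Constraints (d c s r : ℕ) where

  Ω : List (Tabulations d c s r)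
  Ω = allTabulations d c s r

  -- (σ , x , y) asks that the σ-th hash function maps x and y to the same value.
  Constraint : Set
  Constraint = Fin d × Key c s × Key c s

  _⟨_⟩_ : Tabulations d c s r → Fin d → Key c s → Bits r
  H ⟨ σ ⟩ x = hash (lookup H σ) x

  Sat₁ : Tabulations d c s r → Constraint → Set
  Sat₁ H (σ , x , y) = H ⟨ σ ⟩ x ≡ H ⟨ σ ⟩ y

  Sat : List Constraint → Tabulations d c s r → Set
  Sat cs H = All (Sat₁ H) cs

  sat? : ∀ cs → Decidable (Sat cs)
  sat? cs H = All.all? (λ (σ , x , y) → (H ⟨ σ ⟩ x) ≟ᵇ (H ⟨ σ ⟩ y)) cs

  -- Constraints on another hash function avoid the entry for free, since the tabulations are
  -- independent.
  Avoids : Fin d → Fin c → Fin s → Constraint → Set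
  Avoids σ p t (τ , x , y) = τ ≡ σ → lookup x p ≢ t × lookup y p ≢ t

  -- As in a triangular linear system, the head contains an unknown that is absent from the tail.
  -- The pivot lies in the first key of a constraint.
  data Triangular : List Constraint → Set where
    []    : Triangular []
    pivot : ∀ {σ x y cs} p → lookup y p ≢ lookup x p →
            All (Avoids σ p (lookup x p)) cs → Triangular cs → Triangular ((σ , x , y) ∷ cs)

  resample : Fin d → Fin c → Fin s → Bits r → Tabulations d c s r → Tabulations d c s r
  resample σ p t b H = updateAt H σ (λ h → updateAt h p (λ v → updateAt v t (b ⊕_)))

  resample-invariant : ∀ σ p t b → Invariant Ω (resample σ p t b)
  resample-invariant σ p t b =
    vectors-invariant (vectors-invariant (vectors-invariant (⊕-invariant b) t) p) σ

  resample-pivot : ∀ σ p b H x → resample σ p (lookup x p) b H ⟨ σ ⟩ x ≡ b ⊕ (H ⟨ σ ⟩ x)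
  resample-pivot σ p b H x =
    trans (cong (λ h → hash h x) (Vec.lookup∘updateAt σ H)) (hash-resample (lookup H σ) p b x)

  resample-avoided : ∀ σ p {t} b H x → lookup x p ≢ t → resample σ p t b H ⟨ σ ⟩ x ≡ H ⟨ σ ⟩ x
  resample-avoided σ p b H x ≢t =
    trans (cong (λ h → hash h x) (Vec.lookup∘updateAt σ H)) (hash-resample-other (lookup H σ) p b x ≢t)

  resample-sat₁ : ∀ σ p t b H k → Avoids σ p t k → Sat₁ (resample σ p t b H) k → Sat₁ H k
  resample-sat₁ σ p t b H (τ , x , y) av eq with τ Fin.≟ σ
  ... | yes refl = trans (sym (resample-avoided σ p b H x (proj₁ (av refl))))
                     (trans eq (resample-avoided σ p b H y (proj₂ (av refl))))
  ... | no τ≢σ   = subst (λ h → hash h x ≡ hash h y) (Vec.lookup∘updateAt′ τ σ τ≢σ H) eq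

  -- Averages over all shifts `b` of the pivot entry. A shift preserves counts over `Ω` and the
  -- truth of `cs`, while it turns the head into `b ⊕ h(x) ≡ h(y)`, which at most one of the `2 ^ r`
  -- values of `b` satisfies.
  count-triangular-step : ∀ {σ x y cs} p → lookup y p ≢ lookup x p →
    All (Avoids σ p (lookup x p)) cs →
    count (sat? ((σ , x , y) ∷ cs)) Ω * 2 ^ r ≤ count (sat? cs) Ω
  count-triangular-step {σ} {x} {y} {cs} p y≢x avs = begin
    count (sat? cs′) Ω * 2 ^ r                              ≡⟨ *-comm _ (2 ^ r) ⟩
    2 ^ r * count (sat? cs′) Ω                              ≡⟨ cong (_* count (sat? cs′) Ω) (length-allBits r) ⟨
    length (allBits r) * count (sat? cs′) Ω                 ≡⟨ ∑-const (allBits r) _ ⟨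
    ∑ (allBits r) (λ b → count (sat? cs′) Ω)                ≤⟨ ∑-mono (allBits r) shifted ⟩
    ∑ (allBits r) (λ b → count (target? b) Ω)               ≡⟨ ∑-swap (allBits r) Ω (λ b H → ind (target? b H)) ⟩
    ∑ Ω (λ H → count (λ b → target? b H) (allBits r))       ≤⟨ ∑-mono Ω atMostOne ⟩
    count (sat? cs) Ω                                       ∎
    where
    open ≤-Reasoning
    cs′ = (σ , x , y) ∷ cs
    Target : Bits r → Tabulations d c s r → Set
    Target b H = (b ⊕ (H ⟨ σ ⟩ x) ≡ H ⟨ σ ⟩ y) × Sat cs H
    target? : ∀ b → Decidable (Target b)
    target? b H = ((b ⊕ (H ⟨ σ ⟩ x)) ≟ᵇ (H ⟨ σ ⟩ y)) ×-dec sat? cs H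
    untwist : ∀ b H → Sat cs′ (resample σ p (lookup x p) b H) → Target b H
    untwist b H (eq ∷ eqs) =
      trans (sym (resample-pivot σ p b H x)) (trans eq (resample-avoided σ p b H y y≢x)) ,
      All.zipWith (λ {k} (av , e) → resample-sat₁ σ p _ b H k av e) (avs , eqs)
    shifted : ∀ b → count (sat? cs′) Ω ≤ count (target? b) Ω
    shifted b = ≤-trans (≤-reflexive (sym (resample-invariant σ p (lookup x p) b _)))
      (∑-mono Ω λ H → ind-mono (sat? cs′ (resample σ p (lookup x p) b H)) (target? b H) (untwist b H))
    atMostOne : ∀ H → count (λ b → target? b H) (allBits r) ≤ ind (sat? cs H)
    atMostOne H = count-≤ind {P = λ b → Target b H} (λ b → target? b H) (sat? cs H) (allBits-unique r) proj₂
      λ {b} {b′} (e , _) (e′ , _) → ⊕-cancelʳ b b′ _ (trans e (sym e′))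

  count-triangular : ∀ {cs} → Triangular cs → count (sat? cs) Ω * (2 ^ r) ^ length cs ≤ length Ω
  count-triangular {[]} [] = ≤-trans (≤-reflexive (*-identityʳ _)) (count≤length (sat? []) Ω)
  count-triangular {(σ , x , y) ∷ cs} (pivot p y≢x avs tri) = begin
    N * (2 ^ r * (2 ^ r) ^ length cs)         ≡⟨ *-assoc N (2 ^ r) _ ⟨
    N * 2 ^ r * (2 ^ r) ^ length cs           ≤⟨ *-monoˡ-≤ _ (count-triangular-step {σ} {x} {y} {cs} p y≢x avs) ⟩
    count (sat? cs) Ω * (2 ^ r) ^ length cs   ≤⟨ count-triangular tri ⟩
    length Ω                                  ∎
    where
    open ≤-Reasoning
    N = count (sat? ((σ , x , y) ∷ cs)) Ω

-- Union bounds and the enumeration of choices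

length≤∑ : ∀ {xs : List A} {f} → All (λ x → 1 ≤ f x) xs → length xs ≤ ∑ xs f
length≤∑ []       = z≤n
length≤∑ (p ∷ ps) = +-mono-≤ p (length≤∑ ps)

unique-⊆⇒length≤ : DecidableEquality A → ∀ {xs ys : List A} →
                   Unique xs → All (_∈ ys) xs → length xs ≤ length ys
unique-⊆⇒length≤ _≟_ {xs} {ys} xs! xs⊆ys = begin
  length xs                                ≤⟨ length≤∑ (All.map (λ {x} x∈ys → count-some (x ≟_) x∈ys refl) xs⊆ys) ⟩
  ∑ xs (λ x → count (x ≟_) ys)             ≡⟨ ∑-swap xs ys (λ x y → ind (x ≟ y)) ⟩
  ∑ ys (λ y → count (_≟ y) xs)             ≤⟨ ∑-≤-length* ys 1 (All.tabulate λ {y} _ →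
                                               count-unique≤1 (_≟ y) xs! (λ p q → trans p (sym q))) ⟩
  length ys * 1                            ≡⟨ *-identityʳ _ ⟩
  length ys                                ∎
  where open ≤-Reasoning

count-any : ∀ {P : A → B → Set} (P? : ∀ a → Decidable (P a)) as bs →
            count (λ b → any? (λ a → P? a b) as) bs ≤ ∑ as (λ a → count (P? a) bs)
count-any P? as bs = ≤-trans
  (∑-mono bs λ b → ind-≤ (any? (λ a → P? a b) as) λ pas →
    let (a , a∈as , pa) = find pas in count-some (λ a → P? a b) a∈as pa)
  (≤-reflexive (∑-swap bs as (λ b a → ind (P? a b))))

-- The union bound, with the common denominator `k` of the probabilities cleared.
count-any-≤ : ∀ {P : A → B → Set} (P? : ∀ a → Decidable (P a)) {as} bs k N →
              All (λ a → count (P? a) bs * k ≤ N) as →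
              count (λ b → any? (λ a → P? a b) as) bs * k ≤ length as * N
count-any-≤ P? {as} bs k N bounds = begin
  count (λ b → any? (λ a → P? a b) as) bs * k  ≤⟨ *-monoˡ-≤ k (count-any P? as bs) ⟩
  ∑ as (λ a → count (P? a) bs) * k             ≡⟨ ∑-*ʳ as _ k ⟩
  ∑ as (λ a → count (P? a) bs * k)             ≤⟨ ∑-≤-length* as N bounds ⟩
  length as * N                                ∎
  where open ≤-Reasoning

choose : ℕ → List A → List (List A)
choose zero    xs       = [] ∷ []
choose (suc k) []       = []
choose (suc k) (x ∷ xs) = map (x ∷_) (choose k xs) ++ choose (suc k) xs

∈-choose : ∀ {xs ys : List A} → xs ⊆ ys → xs ∈ choose (length xs) ys
∈-choose []                                 = here refl
∈-choose {xs = []}     (y ∷ʳ xs⊆ys)         = here refl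
∈-choose {xs = x ∷ xs} (y ∷ʳ xs⊆ys)         = ∈-++⁺ʳ (map (y ∷_) (choose (length xs) _)) (∈-choose xs⊆ys)
∈-choose {xs = x ∷ xs} (refl ∷ xs⊆ys)       = ∈-++⁺ˡ (∈-map⁺ (x ∷_) (∈-choose xs⊆ys))

-- The left-hand side is the first two terms of the binomial expansion of the right-hand side;
-- Pascal's rule in `length-choose` produces exactly these.
bernoulli : ∀ m k → m ^ suc k + suc k * m ^ k ≤ suc m ^ suc k
bernoulli m zero    = ≤-reflexive (lemma m)
  where
  lemma : ∀ m → m * 1 + (1 + 0) * 1 ≡ (1 + m) * 1
  lemma = solve-∀
bernoulli m (suc k) = begin
  m * (m * m ^ k) + suc (suc k) * (m * m ^ k)                          ≤⟨ m≤m+n _ _ ⟩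
  m * (m * m ^ k) + suc (suc k) * (m * m ^ k) + suc k * m ^ k          ≡⟨ lemma m k (m ^ k) ⟩
  suc m * (m * m ^ k + suc k * m ^ k)                                  ≤⟨ *-monoʳ-≤ (suc m) (bernoulli m k) ⟩
  suc m * (suc m * suc m ^ k)                                          ∎
  where
  open ≤-Reasoning
  lemma : ∀ m k p → m * (m * p) + (2 + k) * (m * p) + (1 + k) * p ≡ (1 + m) * (m * p + (1 + k) * p)
  lemma = solve-∀

-- The factor `k !` is essential: the number of keys may be a large multiple of `2 ^ r`, so ordered
-- choices of `k` keys could outnumber `(2 ^ r) ^ k`.
length-choose : ∀ k (xs : List A) → length (choose k xs) * k ! ≤ length xs ^ k
length-choose zero    xs       = ≤-refl
length-choose (suc k) []       = z≤n
length-choose (suc k) (x ∷ xs) = begin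
  length (map (x ∷_) C ++ C′) * (suc k * k !)
    ≡⟨ cong (_* (suc k * k !)) (trans (length-++ (map (x ∷_) C)) (cong (_+ length C′) (length-map _ C))) ⟩
  (length C + length C′) * (suc k * k !)               ≡⟨ lemma (length C) (length C′) (suc k) (k !) ⟩
  length C′ * (suc k * k !) + suc k * (length C * k !) ≤⟨ +-mono-≤ (length-choose (suc k) xs) (*-monoʳ-≤ (suc k) (length-choose k xs)) ⟩
  length xs ^ suc k + suc k * length xs ^ k            ≤⟨ bernoulli (length xs) k ⟩
  suc (length xs) ^ suc k                              ∎
  where
  open ≤-Reasoning
  C  = choose k xs
  C′ = choose (suc k) xs
  lemma : ∀ a b s f → (a + b) * (s * f) ≡ b * (s * f) + s * (a * f)
  lemma = solve-∀

candidates : ∀ {k} → (Fin k → List A) → List (Vec A k)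
candidates {k = zero}  ls = [] ∷ []
candidates {k = suc k} ls = cartesianProductWith _∷_ (ls zero) (candidates (ls ∘ suc))

∈-candidates : ∀ {k} {ls : Fin k → List A} v → (∀ p → lookup v p ∈ ls p) → v ∈ candidates ls
∈-candidates []      h = here refl
∈-candidates (a ∷ v) h = ∈-cartesianProductWith⁺ _∷_ (h zero) (∈-candidates v (h ∘ suc))

length-candidates : ∀ {k} (ls : Fin k → List A) b → (∀ p → length (ls p) ≤ b) →
                    length (candidates ls) ≤ b ^ k
length-candidates {k = zero}  ls b h = ≤-refl
length-candidates {k = suc k} ls b h =
  ≤-trans (≤-reflexive (length-cartesianProductWith _∷_ (ls zero) (candidates (ls ∘ suc))))
          (*-mono-≤ (h zero) (length-candidates (ls ∘ suc) b (h ∘ suc)))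

∈-vectors : ∀ {as zs : List A} → All (_∈ as) zs →
            ∃[ v ] v ∈ vectors as (length zs) × toList v ≡ zs
∈-vectors []       = [] , here refl , refl
∈-vectors (p ∷ ps) = let (v , v∈ , eq) = ∈-vectors ps in
  _ ∷ v , ∈-cartesianProductWith⁺ _∷_ p v∈ , cong (_ ∷_) eq

-- Peelable sequences of keys

module Peeling (c s : ℕ) where

  Covered : List (Key c s) → Key c s → Fin c → Set
  Covered zs x p = Any (λ z → lookup z p ≡ lookup x p) zs

  covered? : ∀ zs x → Decidable (Covered zs x)
  covered? zs x p = any? (λ z → lookup z p Fin.≟ lookup x p) zs

  data Peelable : List (Key c s) → Set where
    []       : Peelable []
    uncovered : ∀ {x zs} p → ¬ Covered zs x p → Peelable zs → Peelable (x ∷ zs)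

  peelable? : Decidable Peelable
  peelable? [] = yes []
  peelable? (x ∷ zs) with peelable? zs | Fin.any? (λ p → ¬? (covered? zs x p))
  ... | yes pz | yes (p , ¬c) = yes (uncovered p ¬c pz)
  ... | no ¬pz | _            = no λ { (uncovered _ _ pz) → ¬pz pz }
  ... | yes _  | no ∄         = no λ { (uncovered p ¬c _) → ∄ (p , ¬c) }

  keyEq? : DecidableEquality (Key c s)
  keyEq? = Vec.≡-dec Fin._≟_

  covered-length : ∀ {ks zs} → Unique ks → All (λ x → ∀ p → Covered zs x p) ks →
                   length ks ≤ length zs ^ c
  covered-length {ks} {zs} ks! cov = ≤-trans
    (unique-⊆⇒length≤ keyEq? ks! (All.map (λ {x} h → ∈-candidates x (λ p → col x p (h p))) cov))
    (length-candidates column (length zs) (λ p → ≤-reflexive (length-map (λ z → lookup z p) zs)))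
    where
    column : Fin c → List (Fin s)
    column p = map (λ z → lookup z p) zs
    col : ∀ x p → Covered zs x p → lookup x p ∈ column p
    col x p h = let (z , z∈ , eq) = find h in subst (_∈ column p) eq (∈-map⁺ (λ z → lookup z p) z∈)

  -- Greedy choice. The characters of at most `e` chosen keys span a box of at most `e ^ c` keys,
  -- which cannot contain all of `ks`; a key outside the box has an uncovered character.
  extract : ∀ {ks} e → Unique ks → e ^ c < length ks → ∀ i → i ≤ suc e →
            ∃[ zs ] length zs ≡ i × All (_∈ ks) zs × Peelable zs
  extract e ks! long zero i≤ = [] , refl , [] , []
  extract {ks} e ks! long (suc i) (s≤s i≤e)
    with extract e ks! long i (m≤n⇒m≤1+n i≤e)
  ... | zs , refl , zs∈ , peel with All.all? (λ x → Fin.all? (covered? zs x)) ks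
  ... | yes cov = ⊥-elim (<-irrefl refl (<-≤-trans long (≤-trans (covered-length ks! cov) (^-monoˡ-≤ c i≤e))))
  ... | no ¬cov =
    let (x , x∈ , ¬all) = find (All.¬All⇒Any¬ (λ x → Fin.all? (covered? zs x)) ks ¬cov)
        (p , ¬covp)     = Fin.¬∀⟶∃¬ c (Covered zs x) (covered? zs x) ¬all
    in x ∷ zs , refl , x∈ ∷ zs∈ , uncovered p ¬covp peel

-- Collisions within a small set of keys

module Crowding (d c s r : ℕ) where
  open Constraints d c s r
  open Peeling c s public

  chain : Fin d → List (Key c s) → List Constraint
  chain σ []           = []
  chain σ (x ∷ [])     = []
  chain σ (x ∷ y ∷ zs) = (σ , x , y) ∷ chain σ (y ∷ zs)

  length-chain : ∀ σ x zs → length (chain σ (x ∷ zs)) ≡ length zs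
  length-chain σ x []       = refl
  length-chain σ x (y ∷ zs) = cong suc (length-chain σ y zs)

  chain-avoids : ∀ {τ σ p t} zs → All (λ z → lookup z p ≢ t) zs → All (Avoids τ p t) (chain σ zs)
  chain-avoids []           _            = []
  chain-avoids (x ∷ [])     _            = []
  chain-avoids (x ∷ y ∷ zs) (a ∷ b ∷ cs) = (λ _ → a , b) ∷ chain-avoids (y ∷ zs) (b ∷ cs)

  sat-chain : ∀ σ H v {zs} → All (λ z → H ⟨ σ ⟩ z ≡ v) zs → Sat (chain σ zs) H
  sat-chain σ H v []           = []
  sat-chain σ H v (_ ∷ [])     = []
  sat-chain σ H v (a ∷ b ∷ cs) = trans a (sym b) ∷ sat-chain σ H v (b ∷ cs)

  chain-triangular : ∀ σ {zs} → Peelable zs → Triangular (chain σ zs)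
  chain-triangular σ []                  = []
  chain-triangular σ {x ∷ []} (uncovered p _ _) = []
  chain-triangular σ {x ∷ y ∷ zs} (uncovered p ¬cov peel) =
    pivot p (All.head avoid) (chain-avoids (y ∷ zs) avoid) (chain-triangular σ peel)
    where
    avoid : All (λ z → lookup z p ≢ lookup x p) (y ∷ zs)
    avoid = All.¬Any⇒All¬ (y ∷ zs) ¬cov

  Crowded : ℕ → Fin d → List (Key c s) → Tabulations d c s r → Set
  Crowded e σ ks H = Any (λ v → Peelable (toList v) × Sat (chain σ (toList v)) H) (vectors ks (suc e))

  crowded₁? : ∀ σ zs H → Dec (Peelable zs × Sat (chain σ zs) H)
  crowded₁? σ zs H = peelable? zs ×-dec sat? (chain σ zs) H

  crowded? : ∀ e σ ks → Decidable (Crowded e σ ks)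
  crowded? e σ ks H = any? (λ v → crowded₁? σ (toList v) H) (vectors ks (suc e))

  -- A union bound over the sequences of `suc e` keys, in which those that are not peelable
  -- contribute nothing. The common hash value is free, so a sequence has only `e` constraints.
  count-crowded : ∀ e σ ks → count (crowded? e σ ks) Ω * (2 ^ r) ^ e ≤ length ks ^ suc e * length Ω
  count-crowded e σ ks = ≤-trans
    (count-any-≤ (λ v → crowded₁? σ (toList v)) Ω ((2 ^ r) ^ e) (length Ω)
      (All.tabulate {xs = vectors ks (suc e)} λ {v} _ → bound v))
    (≤-reflexive (cong (_* length Ω) (length-vectors ks (suc e))))
    where
    bound : (v : Vec (Key c s) (suc e)) → count (crowded₁? σ (toList v)) Ω * (2 ^ r) ^ e ≤ length Ω
    bound v = by-cases v (peelable? (toList v))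
      where
      open ≤-Reasoning
      by-cases : (v : Vec (Key c s) (suc e)) → Dec (Peelable (toList v)) →
                 count (crowded₁? σ (toList v)) Ω * (2 ^ r) ^ e ≤ length Ω
      by-cases v (no ¬peel) = ≤-trans (≤-reflexive (cong (_* (2 ^ r) ^ e)
                       (count-none (crowded₁? σ (toList v)) Ω (All.tabulate λ _ → ¬peel ∘ proj₁)))) z≤n
      by-cases v@(x ∷ w) (yes peel) = begin
        count (crowded₁? σ (toList v)) Ω * (2 ^ r) ^ e
          ≤⟨ *-monoˡ-≤ ((2 ^ r) ^ e) (count-mono (crowded₁? σ (toList v)) (sat? (chain σ (toList v))) (λ _ → proj₂) Ω) ⟩
        count (sat? (chain σ (toList v))) Ω * (2 ^ r) ^ e
          ≡⟨ cong (λ k → count (sat? (chain σ (toList v))) Ω * (2 ^ r) ^ k)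
               (trans (length-chain σ x (toList w)) (Vec.length-toList w)) ⟨
        count (sat? (chain σ (toList v))) Ω * (2 ^ r) ^ length (chain σ (toList v))
          ≤⟨ count-triangular (chain-triangular σ peel) ⟩
        length Ω ∎

  uncrowded-load : ∀ {e σ ks ys H v} → ¬ Crowded e σ ks H → Unique ys → All (_∈ ks) ys →
                   All (λ y → H ⟨ σ ⟩ y ≡ v) ys → length ys ≤ e ^ c
  uncrowded-load {e} {σ} {ks} {ys} {H} {v} ¬crowded ys! ys∈ks same =
    ≮⇒≥ λ long → let (zs , len , zs∈ , peel) = extract e ys! long (suc e) ≤-refl
                     (w , w∈ , eq)           = ∈-vectors (All.map (All.lookup ys∈ks) zs∈)
                     crowd = subst (λ zs → Peelable zs × Sat (chain σ zs) H) (sym eq)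
                               (peel , sat-chain σ H v (All.map (All.lookup same) zs∈))
                 in ¬crowded (lose′ len w w∈ crowd)
    where
    lose′ : ∀ {k} → k ≡ suc e → (w : Vec (Key c s) k) → w ∈ vectors ks k →
            Peelable (toList w) × Sat (chain σ (toList w)) H → Crowded e σ ks H
    lose′ refl w w∈ crowd = lose w∈ crowd

-- Counting with complements and with exclusive properties

AllPairs-resp-⊆ : ∀ {R : A → A → Set} {xs ys} → xs ⊆ ys → AllPairs R ys → AllPairs R xs
AllPairs-resp-⊆ []             []         = []
AllPairs-resp-⊆ (_ ∷ʳ xs⊆)     (_ ∷ prs)  = AllPairs-resp-⊆ xs⊆ prs
AllPairs-resp-⊆ (refl ∷ xs⊆)   (px ∷ prs) = All-resp-⊆ xs⊆ px ∷ AllPairs-resp-⊆ xs⊆ prs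

count-++-complement : ∀ {P : A → Set} (P? : Decidable P) xs →
                      length xs ≡ count P? xs + length (filter (¬? ∘ P?) xs)
count-++-complement P? []       = refl
count-++-complement P? (x ∷ xs) with P? x
... | yes _ = cong suc (count-++-complement P? xs)
... | no _  = trans (cong suc (count-++-complement P? xs)) (sym (+-suc _ _))

count-apart≤1 : ∀ {P : A → Set} (P? : Decidable P) xs →
                AllPairs (λ x y → P x → ¬ P y) xs → count P? xs ≤ 1
count-apart≤1 P? []       []         = z≤n
count-apart≤1 P? (x ∷ xs) (ap ∷ aps) with P? x
... | yes px = ≤-reflexive (cong suc (count-none P? xs (All.map (λ f → f px) ap)))
... | no _   = count-apart≤1 P? xs aps

count-∃ : ∀ {k} {P : A → Fin k → Set} (P? : ∀ a → Decidable (P a)) xs b →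
          (∀ p → count (λ a → P? a p) xs ≤ b) → count (λ a → Fin.any? (P? a)) xs ≤ k * b
count-∃ {k = k} P? xs b bound = begin
  count (λ a → Fin.any? (P? a)) xs                      ≤⟨ ∑-mono xs (λ a → ind-≤ (Fin.any? (P? a)) λ (p , pa) →
                                                            count-some (P? a) (∈-allFin p) pa) ⟩
  ∑ xs (λ a → ∑ (allFin k) (λ p → ind (P? a p)))        ≡⟨ ∑-swap xs (allFin k) (λ a p → ind (P? a p)) ⟩
  ∑ (allFin k) (λ p → count (λ a → P? a p) xs)          ≤⟨ ∑-≤-length* (allFin k) b (All.tabulate λ {p} _ → bound p) ⟩
  length (allFin k) * b                                 ≡⟨ cong (_* b) (List.length-tabulate {n = k} (λ p → p)) ⟩
  k * b                                                 ∎
  where open ≤-Reasoning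

-- Light position characters

module Keys (c s : ℕ) (X : List (Key c s)) (θ : ℕ) where

  Light : Fin c → Fin s → Set
  Light p t = count (λ x → lookup x p Fin.≟ t) X ≤ θ

  light? : ∀ p t → Dec (Light p t)
  light? p t = _ ≤? θ

  HasLight : Key c s → Set
  HasLight x = ∃[ p ] Light p (lookup x p)

  hasLight? : Decidable HasLight
  hasLight? x = Fin.any? (λ p → light? p (lookup x p))

  MeetsAt : Key c s → Key c s → Fin c → Set
  MeetsAt x y p = Light p (lookup x p) × lookup x p ≡ lookup y p

  record Meets (x y : Key c s) : Set where
    constructor meet
    field
      {position} : Fin c
      meetsAt    : MeetsAt x y position

  meetsAt? : ∀ x y → Decidable (MeetsAt x y)
  meetsAt? x y p = light? p (lookup x p) ×-dec (lookup x p Fin.≟ lookup y p)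

  meets? : ∀ x y → Dec (Meets x y)
  meets? x y = map′ (λ (_ , m) → meet m) (λ (meet m) → _ , m) (Fin.any? (meetsAt? x y))

  meets-sym : ∀ {x y} → Meets x y → Meets y x
  meets-sym (meet (light , eq)) = meet (subst (Light _) eq light , sym eq)

  meets-refl : ∀ {x} → HasLight x → Meets x x
  meets-refl (_ , light) = meet (light , refl)

  Apart : List (Key c s) → Set
  Apart = AllPairs (λ x y → ¬ Meets x y)

  dull : List (Key c s)
  dull = filter (¬? ∘ hasLight?) X

  neighbours : Fin c → Key c s → List (Key c s)
  neighbours p z = filter (λ x → meetsAt? z x p) X

  length-neighbours : ∀ p z → length (neighbours p z) ≤ θ
  length-neighbours p z = ≤-trans (≤-reflexive (length-filter≡count (λ x → meetsAt? z x p) X)) (bound (light? p (lookup z p)))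
    where
    bound : Dec (Light p (lookup z p)) → count (λ x → meetsAt? z x p) X ≤ θ
    bound (yes light) = ≤-trans (count-mono (λ x → meetsAt? z x p) (λ x → lookup x p Fin.≟ lookup z p)
                                   (λ _ → sym ∘ proj₂) X) light
    bound (no heavy)  = ≤-trans (≤-reflexive (count-none (λ x → meetsAt? z x p) X
                                   (All.tabulate λ _ → heavy ∘ proj₁))) z≤n

-- Few keys of a small set share a hash value

module Loads (d c s r : ℕ) (side : Bool → Fin d) (X : List (Key c s)) (X! : Unique X) (θ e : ℕ) where
  open Constraints d c s r public
  open Crowding d c s r public
  open Keys c s X θ public

  -- Sets of neighbours are indexed by keys instead of characters, which keeps their number linear
  -- in `length X` however large the alphabet is.
  smallSets : List (List (Key c s))
  smallSets = dull ∷ cartesianProductWith neighbours (allFin c) X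

  tests : List (Bool × List (Key c s))
  tests = cartesianProductWith _,_ (false ∷ true ∷ []) smallSets

  length-tests : length tests ≡ 2 * suc (c * length X)
  length-tests = trans (length-cartesianProductWith _,_ (false ∷ true ∷ []) smallSets)
    (cong (λ k → 2 * suc k) (trans (length-cartesianProductWith neighbours (allFin c) X)
      (cong (_* length X) (List.length-tabulate {n = c} (λ p → p)))))

  Bad : Tabulations d c s r → Set
  Bad H = Any (λ (σ , ks) → Crowded e (side σ) ks H) tests

  bad? : Decidable Bad
  bad? H = any? (λ (σ , ks) → crowded? e (side σ) ks H) tests

  small-tests : ∀ b → θ ≤ b → length dull ≤ b → All (λ (σ , ks) → length ks ≤ b) tests
  small-tests b θ≤b dull≤b = All.cartesianProductWith⁺ (setoid Bool) (setoid _) _,_ (false ∷ true ∷ []) smallSets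
    λ { {σ} _ (here refl) → dull≤b
      ; {σ} _ (there k∈)  → All.lookup (All.cartesianProductWith⁺ (setoid (Fin c)) (setoid _) neighbours (allFin c) X
                              (λ {p} {z} _ _ → ≤-trans (length-neighbours p z) θ≤b)) k∈ }

  count-bad : ∀ b → θ ≤ b → length dull ≤ b →
              count bad? Ω * (2 ^ r) ^ e ≤ length tests * (b ^ suc e * length Ω)
  count-bad b θ≤b dull≤b = count-any-≤ (λ (σ , ks) → crowded? e (side σ) ks) Ω ((2 ^ r) ^ e) _
    (All.map (λ {(σ , ks)} len → ≤-trans (count-crowded e (side σ) ks) (*-monoˡ-≤ _ (^-monoˡ-≤ (suc e) len)))
      (small-tests b θ≤b dull≤b))

  bool∈ : ∀ σ → σ ∈ false ∷ true ∷ []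
  bool∈ false = here refl
  bool∈ true  = there (here refl)

  record Cluster (H : Tabulations d c s r) (σ : Bool) (v : Bits r) (ys : List (Key c s)) : Set where
    constructor cluster
    field
      ⊆X   : ys ⊆ X
      same : All (λ y → H ⟨ side σ ⟩ y ≡ v) ys

  cluster-⊆ : ∀ {H σ v xs ys} → xs ⊆ ys → Cluster H σ v ys → Cluster H σ v xs
  cluster-⊆ xs⊆ (cluster ys⊆X same) = cluster (⊆-trans xs⊆ ys⊆X) (All-resp-⊆ xs⊆ same)

  cluster-length : ∀ {H σ v ys ks} → ¬ Bad H → (σ , ks) ∈ tests → Cluster H σ v ys →
                   All (_∈ ks) ys → length ys ≤ e ^ c
  cluster-length {H} ¬bad ks∈ (cluster ys⊆X same) ys⊆ks =
    uncrowded-load {H = H} (λ crowded → ¬bad (lose ks∈ crowded)) (AllPairs-resp-⊆ ys⊆X X!) ys⊆ks same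

  length-prune-dull : ∀ {H σ v ys} → ¬ Bad H → Cluster H σ v ys →
                      length ys ≤ e ^ c + length (filter hasLight? ys)
  length-prune-dull {σ = σ} {ys = ys} ¬bad cl = begin
    length ys                                            ≡⟨ count-++-complement hasLight? ys ⟩
    count hasLight? ys + length (filter (¬? ∘ hasLight?) ys)
      ≤⟨ +-monoʳ-≤ _ (cluster-length ¬bad (∈-cartesianProductWith⁺ _,_ (bool∈ σ) (here refl))
           (cluster-⊆ (filter-⊆ _ ys) cl) dull∈) ⟩
    count hasLight? ys + e ^ c                           ≡⟨ +-comm _ (e ^ c) ⟩
    e ^ c + count hasLight? ys                           ≡⟨ cong (e ^ c +_) (length-filter≡count hasLight? ys) ⟨
    e ^ c + length (filter hasLight? ys)                 ∎
    where
    open ≤-Reasoning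
    dull∈ : All (_∈ dull) (filter (¬? ∘ hasLight?) ys)
    dull∈ = All.tabulate λ y∈ → let (y∈ys , ¬light) = ∈-filter⁻ (¬? ∘ hasLight?) {xs = ys} y∈
                                in ∈-filter⁺ (¬? ∘ hasLight?) (Any-resp-⊆ (Cluster.⊆X cl) y∈ys) ¬light

  length-prune-meeting : ∀ {H σ v ys z} → ¬ Bad H → Cluster H σ v ys → z ∈ X →
                         length ys ≤ c * e ^ c + length (filter (¬? ∘ meets? z) ys)
  length-prune-meeting {σ = σ} {ys = ys} {z} ¬bad cl z∈X = begin
    length ys                                                    ≡⟨ count-++-complement (meets? z) ys ⟩
    count (meets? z) ys + length (filter (¬? ∘ meets? z) ys)     ≤⟨ +-monoˡ-≤ _ (count-∃ (meetsAt? z) ys (e ^ c) at) ⟩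
    c * e ^ c + length (filter (¬? ∘ meets? z) ys)               ∎
    where
    open ≤-Reasoning
    at : ∀ p → count (λ y → meetsAt? z y p) ys ≤ e ^ c
    at p = ≤-trans (≤-reflexive (sym (length-filter≡count (λ y → meetsAt? z y p) ys)))
      (cluster-length ¬bad
        (∈-cartesianProductWith⁺ _,_ (bool∈ σ) (there (∈-cartesianProductWith⁺ neighbours (∈-allFin p) z∈X)))
        (cluster-⊆ (filter-⊆ _ ys) cl)
        (All.tabulate λ y∈ → let (y∈ys , m) = ∈-filter⁻ (λ y → meetsAt? z y p) {xs = ys} y∈
                             in ∈-filter⁺ (λ y → meetsAt? z y p) (Any-resp-⊆ (Cluster.⊆X cl) y∈ys) m))

  -- Greedy choice. A chosen key rules out at most `c * e ^ c` keys of the cluster, itself included,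
  -- because a key with a light character meets itself. The premise `1 ≤ c * e ^ c` makes the length
  -- condition fail on an empty list.
  pick : ∀ {H σ v} M {ys} → ¬ Bad H → Cluster H σ v ys → All HasLight ys → 1 ≤ c * e ^ c →
         M * (c * e ^ c) ≤ length ys → ∃[ zs ] zs ⊆ ys × length zs ≡ M × Apart zs
  pick zero    ¬bad cl lights 1≤ long = [] , minimum _ , refl , []
  pick (suc M) {[]} ¬bad cl lights 1≤ long = ⊥-elim (<-irrefl refl (<-≤-trans 1≤ (≤-trans (m≤m+n _ _) long)))
  pick (suc M) {y ∷ ys} ¬bad cl (light ∷ lights) 1≤ long
    with pick M {filter (¬? ∘ meets? y) ys} ¬bad (cluster-⊆ (y ∷ʳ filter-⊆ _ ys) cl) (All.filter⁺ (¬? ∘ meets? y) lights) 1≤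
           (+-cancelˡ-≤ (c * e ^ c) _ _ (≤-trans long (≤-trans (length-prune-meeting ¬bad cl (Any-resp-⊆ (Cluster.⊆X cl) (here refl)))
             (≤-reflexive (cong (λ l → c * e ^ c + length l) (filter-reject (¬? ∘ meets? y) (λ ¬m → ¬m (meets-refl light))))))))
  ... | zs , zs⊆ , len , apart =
    y ∷ zs , refl ∷ ⊆-trans zs⊆ (filter-⊆ _ ys) , cong suc len ,
    All-resp-⊆ zs⊆ (All.all-filter (¬? ∘ meets? y) ys) ∷ apart

∈-choose⁻ : ∀ k {zs ys : List A} → zs ∈ choose k ys → zs ⊆ ys × length zs ≡ k
∈-choose⁻ zero    (here refl) = minimum _ , refl
∈-choose⁻ (suc k) {ys = y ∷ ys} zs∈ with ∈-++⁻ (map (y ∷_) (choose k ys)) zs∈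
... | inj₁ zs∈₁ = let (ws , ws∈ , eq) = ∈-map⁻ (y ∷_) zs∈₁
                      (ws⊆ , len)     = ∈-choose⁻ k ws∈
                  in subst (λ zs → zs ⊆ y ∷ ys × length zs ≡ suc k) (sym eq) (refl ∷ ws⊆ , cong suc len)
... | inj₂ zs∈₂ = let (zs⊆ , len) = ∈-choose⁻ (suc k) zs∈₂ in y ∷ʳ zs⊆ , len

length-concatMap : ∀ (f : A → List B) b xs → (∀ x → length (f x) ≤ b) → length (concatMap f xs) ≤ length xs * b
length-concatMap f b []       bound = z≤n
length-concatMap f b (x ∷ xs) bound = ≤-trans (≤-reflexive (length-++ (f x)))
  (+-mono-≤ (bound x) (length-concatMap f b xs bound))

-- P is R to the number of constraints so far; the nb bad and ng good options
-- account for sb and sg outcomes.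
step-bound : ∀ {R Rᴹ} .{{_ : NonZero R}} .{{_ : NonZero Rᴹ}} cnt sb sg nb ng P N β B W → 1 ≤ β →
  cnt ≤ sb + sg →
  sb * (R * P * (2 * W) * B) ≤ nb * (N * (B + 2 * W)) →
  sg * (Rᴹ * P * W * (β * B)) ≤ ng * (N * (β * B + W)) →
  4 * nb * β ≤ R → 4 * ng ≤ Rᴹ →
  cnt * (P * (2 * W) * (β * B)) ≤ N * (β * B + 2 * W)
step-bound {R} {Rᴹ} cnt sb sg nb ng P N β B W 1≤β cover bad good nb≤ ng≤ = *-cancelˡ-≤ 4 (begin
  4 * (cnt * (P * (2 * W) * (β * B)))                        ≤⟨ *-monoʳ-≤ 4 (*-monoˡ-≤ _ cover) ⟩
  4 * ((sb + sg) * (P * (2 * W) * (β * B)))                  ≡⟨ cong (4 *_) (*-distribʳ-+ _ sb sg) ⟩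
  4 * (S + G)                                                ≡⟨ *-distribˡ-+ 4 S G ⟩
  4 * S + 4 * G                                              ≤⟨ +-mono-≤ S≤ G≤ ⟩
  N * (B + 2 * W) + N * (2 * (β * B + W))                    ≤⟨ +-monoˡ-≤ _ (*-monoʳ-≤ N (+-monoˡ-≤ (2 * W) (≤-trans (≤-reflexive (sym (*-identityˡ B))) (*-monoˡ-≤ B 1≤β)))) ⟩
  N * (β * B + 2 * W) + N * (2 * (β * B + W))                ≤⟨ m≤m+n _ (N * (β * B + 4 * W)) ⟩
  N * (β * B + 2 * W) + N * (2 * (β * B + W)) + N * (β * B + 4 * W)  ≡⟨ collect N (β * B) W ⟩
  4 * (N * (β * B + 2 * W))                                  ∎)
  where
  open ≤-Reasoning
  S = sb * (P * (2 * W) * (β * B))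
  G = sg * (P * (2 * W) * (β * B))
  collect : ∀ N x W → N * (x + 2 * W) + N * (2 * (x + W)) + N * (x + 4 * W) ≡ 4 * (N * (x + 2 * W))
  collect = solve-∀
  arrangeS : ∀ R s P W β B → R * (4 * (s * (P * (2 * W) * (β * B)))) ≡ 4 * β * (s * (R * P * (2 * W) * B))
  arrangeS = solve-∀
  arrangeS′ : ∀ β n m → 4 * β * (n * m) ≡ (4 * n * β) * m
  arrangeS′ = solve-∀
  arrangeG : ∀ R s P W x → R * (4 * (s * (P * (2 * W) * x))) ≡ 8 * (s * (R * P * W * x))
  arrangeG = solve-∀
  arrangeG′ : ∀ n N x → 8 * (n * (N * x)) ≡ (4 * n) * (N * (2 * x))
  arrangeG′ = solve-∀
  -- The new constraint gains `R`, the options cost `nb`, and the unit of budget that was spent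
  -- costs `β`; by `4 * nb * β ≤ R` the bad outcomes use at most a quarter of each term of the
  -- target.
  S≤ : 4 * S ≤ N * (B + 2 * W)
  S≤ = *-cancelˡ-≤ R (begin
    R * (4 * S)                          ≡⟨ arrangeS R sb P W β B ⟩
    4 * β * (sb * (R * P * (2 * W) * B)) ≤⟨ *-monoʳ-≤ (4 * β) bad ⟩
    4 * β * (nb * (N * (B + 2 * W)))     ≡⟨ arrangeS′ β nb _ ⟩
    4 * nb * β * (N * (B + 2 * W))       ≤⟨ *-monoˡ-≤ _ nb≤ ⟩
    R * (N * (B + 2 * W))                ∎)
  -- One vertex fewer left to explore costs a factor 2 in one of the two terms. By `4 * ng ≤ Rᴹ` the
  -- good outcomes use half of that term and a quarter of the other.
  G≤ : 4 * G ≤ N * (2 * (β * B + W))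
  G≤ = *-cancelˡ-≤ Rᴹ (begin
    Rᴹ * (4 * G)                         ≡⟨ arrangeG Rᴹ sg P W (β * B) ⟩
    8 * (sg * (Rᴹ * P * W * (β * B)))    ≤⟨ *-monoʳ-≤ 8 good ⟩
    8 * (ng * (N * (β * B + W)))         ≡⟨ arrangeG′ ng N (β * B + W) ⟩
    4 * ng * (N * (2 * (β * B + W)))     ≤⟨ *-monoˡ-≤ _ ng≤ ⟩
    Rᴹ * (N * (2 * (β * B + W)))         ∎)

-- Exploring witness trees

module Exploration (d c s r : ℕ) (side : Bool → Fin d) (sides-differ : side false ≢ side true)
  (X : List (Key c s)) (X! : Unique X) (θ e : ℕ) (L M : ℕ) where
  open Loads d c s r side X X! θ e public

  side-not : ∀ σ → side (not σ) ≢ side σ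
  side-not false eq = sides-differ (sym eq)
  side-not true  eq = sides-differ eq

  -- A vertex of the hash graph is a side σ with a hash value v; keys are edges.
  rich : Tabulations d c s r → ℕ → Bool → Bits r → Bool
  Branch : Tabulations d c s r → ℕ → Bool → Bits r → Key c s → Set
  branch? : ∀ H j σ v → Decidable (Branch H j σ v)

  rich H zero    σ v = true
  rich H (suc j) σ v = L ≤ᵇ length (filter (branch? H j σ v) X)
  Branch H j σ v x = H ⟨ side σ ⟩ x ≡ v × T (rich H j (not σ) (H ⟨ side (not σ) ⟩ x))
  branch? H j σ v x = ((H ⟨ side σ ⟩ x) ≟ᵇ v) ×-dec T? (rich H j (not σ) (H ⟨ side (not σ) ⟩ x))

  -- The root takes a level of its own: it is not reached through an edge, so its edges collide in a
  -- chain, and only their other ends are explored, to depth `k`.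
  Rooted : ℕ → Tabulations d c s r → Set
  Rooted k H = Any (λ x → T (rich H (suc k) false (H ⟨ side false ⟩ x))) X

  rooted? : ∀ k → Decidable (Rooted k)
  rooted? k H = any? (λ x → T? _) X

  -- (z , σ , j): the end on side σ of the edge z is still to be explored to depth j.
  Pending : Set
  Pending = Key c s × Bool × ℕ

  RichAt : Tabulations d c s r → Pending → Set
  RichAt H (z , σ , j) = T (rich H j σ (H ⟨ side σ ⟩ z))

  Event : List Constraint → List Pending → Tabulations d c s r → Set
  Event cs P H = ¬ Bad H × Sat cs H × All (RichAt H) P

  event? : ∀ cs P → Decidable (Event cs P)
  event? cs P H = ¬? (bad? H) ×-dec sat? cs H ×-dec All.all? (λ (z , σ , j) → T? _) P

  keys : List Constraint → List (Key c s)
  keys []                 = []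
  keys ((_ , x , y) ∷ cs) = x ∷ y ∷ keys cs

  length-keys : ∀ cs → length (keys cs) ≡ 2 * length cs
  length-keys []       = refl
  length-keys (_ ∷ cs) = trans (cong (2 +_) (length-keys cs)) (sym (*-suc 2 (length cs)))

  -- Keeps every light character of `z` available as a pivot in the table of `σ`. Constraints on the
  -- other table may contain `z`, and those through which it was found do.
  Untouched : Key c s → Bool → Constraint → Set
  Untouched z σ (τ , x , y) = τ ≡ side σ → ¬ Meets z x × ¬ Meets z y

  -- Because of `known`, new edges need only be checked against `keys cs`: this separates them from
  -- the edge being explored and from all pending edges at once.
  record Fresh (cs : List Constraint) (q : Pending) : Set where
    constructor fresh
    field
      light     : HasLight (proj₁ q)
      inX       : proj₁ q ∈ X
      known     : proj₁ q ∈ keys cs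
      untouched : All (Untouched (proj₁ q) (proj₁ (proj₂ q))) cs

  ApartP : List Pending → Set
  ApartP = AllPairs (λ q q′ → ¬ Meets (proj₁ q) (proj₁ q′))

  record Valid (cs : List Constraint) (P : List Pending) : Set where
    constructor valid
    field
      triangular : Triangular cs
      freshness  : All (Fresh cs) P
      apart      : ApartP P

  ¬meets⇒≢ : ∀ {x y p} → Light p (lookup x p) → ¬ Meets x y → lookup y p ≢ lookup x p
  ¬meets⇒≢ light ¬m eq = ¬m (meet (light , sym eq))

  untouched⇒avoids : ∀ {z σ p} → Light p (lookup z p) → ∀ k → Untouched z σ k →
                     Avoids (side σ) p (lookup z p) k
  untouched⇒avoids light _ un eq = let (a , b) = un eq in ¬meets⇒≢ light a , ¬meets⇒≢ light b

  fresh-weaken : ∀ {k cs q} → Untouched (proj₁ q) (proj₁ (proj₂ q)) k → Fresh cs q → Fresh (k ∷ cs) q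
  fresh-weaken un (fresh light inX known untouched) = fresh light inX (there (there known)) (un ∷ untouched)

  -- A key x at the vertex of z that meets an earlier key.  The constraint has its
  -- pivot in z, and the pending edges that x meets are given up.

  remaining : Key c s → List Pending → List Pending
  remaining x = filter (λ q → ¬? (meets? (proj₁ q) x))

  bad-valid : ∀ {cs z σ j P x} → Valid cs ((z , σ , j) ∷ P) → ¬ Meets z x →
              Valid ((side σ , z , x) ∷ cs) (remaining x P)
  bad-valid {cs} {z} {σ} {j} {P} {x} (valid tri (fresh (p , light) _ _ un ∷ freshP) (z# ∷ apartP)) ¬m =
    valid (pivot p (¬meets⇒≢ light ¬m) (All.map (λ {k} → untouched⇒avoids light k) un) tri)
      (All.tabulate λ {q} q∈ → let (q∈P , ¬mx) = ∈-filter⁻ (λ q → ¬? (meets? (proj₁ q) x)) {xs = P} q∈ in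
        fresh-weaken (λ _ → All.lookup z# q∈P ∘ meets-sym , ¬mx) (All.lookup freshP q∈P))
      (AllPairs.filter⁺ (λ q → ¬? (meets? (proj₁ q) x)) apartP)

  -- The pending edges are pairwise apart, so at each of the `c` positions at most one of them
  -- shares the light character of `x`.
  length-remaining : ∀ {cs P} x → Valid cs P → length P ≤ c + length (remaining x P)
  length-remaining {P = P} x (valid _ _ apartP) = begin
    length P                                       ≡⟨ count-++-complement (λ q → meets? (proj₁ q) x) P ⟩
    count (λ q → meets? (proj₁ q) x) P + length (remaining x P)
      ≤⟨ +-monoˡ-≤ (length (remaining x P)) (count-∃ (λ q → meetsAt? (proj₁ q) x) P 1 λ p →
           count-apart≤1 (λ q → meetsAt? (proj₁ q) x p) P
             (AllPairs.map (λ ¬m (light , eq) (_ , eq′) → ¬m (meet (light , trans eq (sym eq′)))) apartP)) ⟩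
    c * 1 + length (remaining x P)                 ≡⟨ cong (_+ length (remaining x P)) (*-identityʳ c) ⟩
    c + length (remaining x P)                     ∎
    where open ≤-Reasoning

  meeting : Key c s → List (Key c s)
  meeting y = concatMap (λ p → neighbours p y) (allFin c)

  badOptions : List Constraint → Key c s → List (Key c s)
  badOptions cs z = filter (¬? ∘ meets? z) (concatMap meeting (keys cs))

  length-badOptions : ∀ cs z → length (badOptions cs z) ≤ 2 * length cs * (c * θ)
  length-badOptions cs z = ≤-trans (List.length-filter (¬? ∘ meets? z) (concatMap meeting (keys cs)))
    (≤-trans (length-concatMap meeting (c * θ) (keys cs) λ y →
        ≤-trans (length-concatMap (λ p → neighbours p y) θ (allFin c) (λ p → length-neighbours p y))
          (≤-reflexive (cong (_* θ) (List.length-tabulate {n = c} (λ p → p)))))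
      (≤-reflexive (cong (_* (c * θ)) (length-keys cs))))

  ∈-badOptions : ∀ {cs z x y} → x ∈ X → y ∈ keys cs → Meets y x → ¬ Meets z x → x ∈ badOptions cs z
  ∈-badOptions {cs} {z} {x} {y} x∈X y∈ (meet {p} m) ¬m = ∈-filter⁺ (¬? ∘ meets? z)
    (∈-concatMap⁺ meeting (lose y∈ (∈-concatMap⁺ (λ p → neighbours p y) (lose (∈-allFin p) (∈-filter⁺ (λ x → meetsAt? y x p) x∈X m)))))
    ¬m

  Clear : List (Key c s) → Key c s → Set
  Clear ks y = All (λ k → ¬ Meets y k) ks

  clear? : ∀ ks → Decidable (Clear ks)
  clear? ks y = All.all? (λ k → ¬? (meets? y k)) ks

  children : Key c s → Bool → List (Key c s) → List Constraint → List Constraint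
  children z σ zs cs = map (λ y → side σ , y , z) zs ++ cs

  pendings : Bool → ℕ → List (Key c s) → List Pending → List Pending
  pendings σ j zs P = map (λ y → y , σ , j) zs ++ P

  clear⇒untouched : ∀ {y σ} cs → Clear (keys cs) y → All (Untouched y σ) cs
  clear⇒untouched []       []              = []
  clear⇒untouched (_ ∷ cs) (¬a ∷ ¬b ∷ ¬cs) = (λ _ → ¬a , ¬b) ∷ clear⇒untouched cs ¬cs

  good-triangular : ∀ {z σ zs cs} → Triangular cs → All HasLight zs → Apart zs →
                    All (Clear (keys cs)) zs → z ∈ keys cs → Triangular (children z σ zs cs)
  good-triangular tri []             []         []         z∈ = tri
  good-triangular {z} {σ} {y ∷ zs} {cs} tri ((p , light) ∷ ls) (y# ∷ ap) (cl ∷ cls) z∈ =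
    pivot p (¬meets⇒≢ light (All.lookup cl z∈))
      (All.++⁺ (All.map⁺ (All.map (λ ¬m _ → ¬meets⇒≢ light ¬m , ¬meets⇒≢ light (All.lookup cl z∈)) y#))
               (All.map (λ {k} → untouched⇒avoids light k) (clear⇒untouched cs cl)))
      (good-triangular tri ls ap cls z∈)

  ∈-keys-children : ∀ {z σ cs} zs → (∀ {y} → y ∈ zs → y ∈ keys (children z σ zs cs)) ×
                                   (∀ {y} → y ∈ keys cs → y ∈ keys (children z σ zs cs))
  ∈-keys-children []       = (λ ()) , (λ y∈ → y∈)
  ∈-keys-children (x ∷ zs) = let (new , old) = ∈-keys-children zs in
    (λ { (here refl) → here refl ; (there y∈) → there (there (new y∈)) }) , λ y∈ → there (there (old y∈))

  pendings-apart : ∀ {σ j zs P} → Apart zs → ApartP P →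
                   All (λ y → All (λ q → ¬ Meets y (proj₁ q)) P) zs → ApartP (pendings σ j zs P)
  pendings-apart apart apartP cross = AllPairs.++⁺ (AllPairs.map⁺ apart) apartP (All.map⁺ cross)

  -- The new edges are pending in the table of `not σ`, which their own constraints do not concern.
  -- Those constraints contain only new edges and `z`; an old pending edge meets neither, as it is
  -- known and apart from `z`.
  good-valid : ∀ {cs z σ j j′ P zs} → Valid cs ((z , σ , j) ∷ P) → zs ⊆ X → All HasLight zs → Apart zs →
               All (Clear (keys cs)) zs → Valid (children z σ zs cs) (pendings (not σ) j′ zs P)
  good-valid {cs} {z} {σ} {zs = zs} (valid tri (fresh _ _ z∈ _ ∷ freshP) (z# ∷ apartP)) zs⊆X lights apart clear =
    valid (good-triangular tri lights apart clear z∈)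
      (All.++⁺ (All.map⁺ (All.tabulate λ {y} y∈ →
           fresh (All.lookup lights y∈) (Any-resp-⊆ zs⊆X y∈) (proj₁ (∈-keys-children zs) y∈)
             (All.++⁺ (All.map⁺ (All.tabulate λ _ eq → ⊥-elim (side-not σ (sym eq))))
                      (clear⇒untouched cs (All.lookup clear y∈)))))
         (All.tabulate λ {q} q∈ → let fresh l i k u = All.lookup freshP q∈ in
           fresh l i (proj₂ (∈-keys-children zs) k)
             (All.++⁺ (All.map⁺ (All.map (λ cl _ → All.lookup cl k ∘ meets-sym , All.lookup z# q∈ ∘ meets-sym) clear)) u)))
      (pendings-apart apart apartP (All.map (λ cl → All.map (λ f → All.lookup cl (Fresh.known f)) freshP) clear))

  Suitable : List Constraint → List (Key c s) → Set
  Suitable cs zs = All HasLight zs × Apart zs × All (Clear (keys cs)) zs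

  suitable? : ∀ cs → Decidable (Suitable cs)
  suitable? cs zs = All.all? hasLight? zs ×-dec AllPairs.allPairs? (λ x y → ¬? (meets? x y)) zs
                      ×-dec All.all? (clear? (keys cs)) zs

  goodOptions : List Constraint → List (List (Key c s))
  goodOptions cs = filter (suitable? cs) (choose M X)

  module _ (enough : e ^ c + c * e ^ c + M * (c * e ^ c) ≤ L) (1≤ : 1 ≤ c * e ^ c) where

    sat-children : ∀ {H z σ zs cs} → All (λ y → H ⟨ side σ ⟩ y ≡ H ⟨ side σ ⟩ z) zs → Sat cs H →
                   Sat (children z σ zs cs) H
    sat-children eqs sat = All.++⁺ (All.map⁺ eqs) sat

    rich-pick : ∀ {H j σ v} → ¬ Bad H → T (rich H (suc j) σ v) →
                ∃[ ys ] Cluster H σ v ys × All HasLight ys × c * e ^ c + M * (c * e ^ c) ≤ length ys ×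
                        All (Branch H j σ v) ys
    rich-pick {H} {j} {σ} {v} ¬bad rich-v =
      filter hasLight? V , cluster-⊆ (filter-⊆ hasLight? V) clV , All.all-filter hasLight? V ,
      +-cancelˡ-≤ (e ^ c) _ _ (≤-trans (≤-trans (≤-reflexive (sym (+-assoc (e ^ c) (c * e ^ c) (M * (c * e ^ c))))) enough)
        (≤-trans (≤ᵇ⇒≤ L _ rich-v) (length-prune-dull ¬bad clV))) ,
      All.filter⁺ hasLight? (All.all-filter (branch? H j σ v) X)
      where
      V = filter (branch? H j σ v) X
      clV : Cluster H σ v V
      clV = cluster (filter-⊆ (branch? H j σ v) X) (All.map proj₁ (All.all-filter (branch? H j σ v) X))

    -- The summands of `enough` say where the `L` branches go: `e ^ c` may be dull, `c * e ^ c` may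
    -- meet `z`, as `z` itself does, and `pick` needs the rest. If one of the branches left meets a
    -- known key, it is a bad option; otherwise all of them are clear.
    step : ∀ {H cs z σ j P} → Valid cs ((z , σ , suc j) ∷ P) → Event cs ((z , σ , suc j) ∷ P) H →
      (∃[ x ] x ∈ badOptions cs z × Event ((side σ , z , x) ∷ cs) (remaining x P) H) ⊎
      (∃[ zs ] zs ∈ goodOptions cs × Event (children z σ zs cs) (pendings (not σ) j zs P) H)
    step {H} {cs} {z} {σ} {j} {P} (valid tri (fresh l z∈X z∈ un ∷ freshP) _) (¬bad , sat , rz ∷ rP)
      with rich-pick {H} {j} {σ} ¬bad rz
    ... | ys , cl , lights , long , branches
      with any? (λ x → any? (λ k → meets? k x) (keys cs)) (filter (¬? ∘ meets? z) ys)
    ... | yes found =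
      let (x , x∈ , hit)  = find found
          (k , k∈ , m)    = find hit
          (x∈ys , ¬mzx)   = ∈-filter⁻ (¬? ∘ meets? z) {xs = ys} x∈
      in inj₁ (x , ∈-badOptions (Any-resp-⊆ (Cluster.⊆X cl) x∈ys) k∈ m ¬mzx ,
               ¬bad , sym (All.lookup (Cluster.same cl) x∈ys) ∷ sat , All.filter⁺ (λ q → ¬? (meets? (proj₁ q) x)) rP)
    ... | no none =
      let ws                      = filter (¬? ∘ meets? z) ys
          ws⊆ys                   = filter-⊆ (¬? ∘ meets? z) ys
          clw                     = cluster-⊆ ws⊆ys cl
          lightsw                 = All-resp-⊆ ws⊆ys lights
          (zs , zs⊆ , len , apart) = pick M ¬bad clw lightsw 1≤
             (+-cancelˡ-≤ (c * e ^ c) _ _ (≤-trans long (length-prune-meeting ¬bad cl z∈X)))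
          clear : All (Clear (keys cs)) zs
          clear = All.tabulate λ {y} y∈ → All.tabulate λ {k} k∈ m →
                    none (lose (Any-resp-⊆ zs⊆ y∈) (lose k∈ (meets-sym m)))
          zs∈ = subst (λ k → zs ∈ choose k X) len (∈-choose (⊆-trans zs⊆ (Cluster.⊆X clw)))
          branchesz = All-resp-⊆ (⊆-trans zs⊆ ws⊆ys) branches
      in inj₂ (zs , ∈-filter⁺ (suitable? cs) zs∈ (All-resp-⊆ zs⊆ lightsw , apart , clear) ,
               ¬bad , sat-children {H} {zs = zs} (All.map proj₁ branchesz) sat , All.++⁺ (All.map⁺ (All.map proj₂ branchesz)) rP)

⊆-++-split : ∀ (xs : List A) {ys zs} → zs ⊆ xs ++ ys →
             ∃[ us ] ∃[ vs ] zs ≡ us ++ vs × us ⊆ xs × vs ⊆ ys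
⊆-++-split []       zs⊆         = [] , _ , refl , [] , zs⊆
⊆-++-split (x ∷ xs) (_ ∷ʳ zs⊆)  = let (us , vs , eq , us⊆ , vs⊆) = ⊆-++-split xs zs⊆ in
  us , vs , eq , x ∷ʳ us⊆ , vs⊆
⊆-++-split (x ∷ xs) (refl ∷ zs⊆) = let (us , vs , eq , us⊆ , vs⊆) = ⊆-++-split xs zs⊆ in
  x ∷ us , vs , cong (x ∷_) eq , refl ∷ us⊆ , vs⊆

-- The number of inner nodes of a binary tree of depth j.
nodes : ℕ → ℕ
nodes zero    = 0
nodes (suc j) = suc (nodes j + nodes j)

-- The probability of a long exploration

module Counting (d c s r : ℕ) (side : Bool → Fin d) (sides-differ : side false ≢ side true)
  (X : List (Key c s)) (X! : Unique X) (θ e : ℕ) (L M : ℕ)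
  (enough : e ^ c + c * e ^ c + M * (c * e ^ c) ≤ L) (1≤ : 1 ≤ c * e ^ c)
  (Q β : ℕ) (1≤β : 1 ≤ β) (few-bad : 4 * (2 * Q * (c * θ)) * β ≤ 2 ^ r)
  (few-good : 4 * length (choose M X) ≤ (2 ^ r) ^ M) where
  open Exploration d c s r side sides-differ X X! θ e L M

  weight : List Pending → ℕ
  weight P = ∑ P (λ (_ , _ , j) → nodes j)

  -- Even after b bad steps, which give up at most c + 1 pending edges each, there
  -- are n vertices left to explore.
  Lasting : ℕ → ℕ → List Pending → Set
  Lasting b n P = ∀ {Q} → Q ⊆ P → length P ≤ length Q + suc c * b → n ≤ weight Q

  weight-level : ∀ {j Q} → All (λ (_ , _ , i) → i ≡ j) Q → weight Q ≡ length Q * nodes j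
  weight-level []           = refl
  weight-level (refl ∷ eqs) = cong (nodes _ +_) (weight-level eqs)

  pendings-level : ∀ {σ j Q} zs → Q ⊆ map (λ y → y , σ , j) zs → weight Q ≡ length Q * nodes j
  pendings-level zs Q⊆ = weight-level (All-resp-⊆ Q⊆ (All.map⁺ (All.tabulate {xs = zs} λ _ → refl)))

  lasting-skip : ∀ {b n q P} → proj₂ (proj₂ q) ≡ 0 → Lasting b n (q ∷ P) → Lasting b n P
  lasting-skip {b} {n} {q} refl last {Q} Q⊆ len = last (refl {x = q} ∷ Q⊆) (s≤s len)

  -- In `suc c`, the successor pays for the abandoned vertex `q` and `c` for the pending edges that
  -- meet `x`.
  lasting-bad : ∀ {b n q P} x → length P ≤ c + length (remaining x P) →
                Lasting (suc b) n (q ∷ P) → Lasting b n (remaining x P)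
  lasting-bad {b} {n} {q} {P} x few last {Q} Q⊆ len = last (q ∷ʳ ⊆-trans Q⊆ (filter-⊆ _ P)) (begin
    suc (length P)                               ≤⟨ s≤s few ⟩
    suc c + length (remaining x P)               ≤⟨ +-monoʳ-≤ (suc c) len ⟩
    suc c + (length Q + suc c * b)               ≡⟨ arrange (suc c) (length Q) (suc c * b) ⟩
    length Q + (suc c + suc c * b)               ≡⟨ cong (length Q +_) (*-suc (suc c) b) ⟨
    length Q + suc c * suc b                     ∎)
    where
    open ≤-Reasoning
    arrange : ∀ a l m → a + (l + m) ≡ l + (a + m)
    arrange = solve-∀

  two-children : ∀ {b u v P zs : ℕ} → suc c * b + 2 ≤ zs → u ≤ zs → v ≤ P → zs + P ≤ (u + v) + suc c * b →
                 2 ≤ u × P ≤ v + suc c * b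
  two-children {b} {u} {v} {P} {zs} M≥ u≤ v≤ len =
    +-cancelˡ-≤ (suc c * b) _ _ (+-cancelʳ-≤ P _ _ (begin
      suc c * b + 2 + P       ≤⟨ +-monoˡ-≤ P M≥ ⟩
      zs + P                  ≤⟨ len ⟩
      u + v + suc c * b       ≡⟨ arrange₁ u v (suc c * b) ⟩
      suc c * b + u + v       ≤⟨ +-monoʳ-≤ _ v≤ ⟩
      suc c * b + u + P       ∎)) ,
    +-cancelˡ-≤ zs _ _ (begin
      zs + P                  ≤⟨ len ⟩
      u + v + suc c * b       ≡⟨ +-assoc u v _ ⟩
      u + (v + suc c * b)     ≤⟨ +-monoˡ-≤ _ u≤ ⟩
      zs + (v + suc c * b)    ∎)
    where
    open ≤-Reasoning
    arrange₁ : ∀ u v m → u + v + m ≡ m + u + v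
    arrange₁ = solve-∀

  -- Losing `suc c * b` edges leaves at least two children. Their weight `nodes j + nodes j` is one
  -- less than that of the explored vertex, so the step uses up exactly one of the `suc n` vertices.
  lasting-good : ∀ {b n z σ σ′ j P zs} → suc c * b + 2 ≤ length zs →
                 Lasting b (suc n) ((z , σ , suc j) ∷ P) → Lasting b n (pendings σ′ j zs P)
  lasting-good {b} {n} {z} {σ} {σ′} {j} {P} {zs} M≥ last {Q} Q⊆ len
    with ⊆-++-split (map (λ y → y , σ′ , j) zs) Q⊆
  ... | us , vs , refl , us⊆ , vs⊆ = s≤s⁻¹ (begin
    suc n                                                ≤⟨ last (refl {x = z , σ , suc j} ∷ vs⊆) (s≤s (proj₂ two)) ⟩
    suc (nodes j + nodes j) + weight vs                  ≤⟨ +-monoˡ-≤ (weight vs) (s≤s twice) ⟩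
    suc (weight us + weight vs)                          ≡⟨ cong suc (∑-++ us vs _) ⟨
    suc (weight (us ++ vs))                              ∎)
    where
    open ≤-Reasoning
    len-zs : length (map (λ y → y , σ′ , j) zs) ≡ length zs
    len-zs = length-map _ zs
    two : 2 ≤ length us × length P ≤ length vs + suc c * b
    two = two-children {b} {length us} {length vs} {length P} {length zs} M≥
      (≤-trans (length-mono-≤ us⊆) (≤-reflexive len-zs)) (length-mono-≤ vs⊆)
      (≤-trans (≤-reflexive (trans (cong (_+ length P) (sym len-zs)) (sym (length-++ (map (λ y → y , σ′ , j) zs)))))
        (≤-trans len (≤-reflexive (cong (_+ suc c * b) (length-++ us)))))
    twice : nodes j + nodes j ≤ weight us
    twice = begin
      nodes j + nodes j       ≡⟨ cong (nodes j +_) (+-identityʳ (nodes j)) ⟨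
      2 * nodes j             ≤⟨ *-monoˡ-≤ (nodes j) (proj₁ two) ⟩
      length us * nodes j     ≡⟨ pendings-level zs us⊆ ⟨
      weight us               ∎

  N : ℕ
  N = length Ω

  instance
    2^r≢0 : NonZero (2 ^ r)
    2^r≢0 = m^n≢0 2 r

  count-event-≤ : ∀ {cs P} → Valid cs P → count (event? cs P) Ω * (2 ^ r) ^ length cs ≤ N
  count-event-≤ {cs} {P} v = ≤-trans
    (*-monoˡ-≤ _ (count-mono (event? cs P) (sat? cs) (λ _ → proj₁ ∘ proj₂) Ω)) (count-triangular (Valid.triangular v))

  open ≤-Reasoning

  -- Up to cleared denominators, the probability is at most `2 ^ -n + β ^ -b` divided by
  -- `(2 ^ r) ^ length cs`. When `n` or `b` reaches 0, one of the two terms is 1 and the constraints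
  -- alone give the bound.
  Bounded : ℕ → ℕ → List Constraint → List Pending → Set
  Bounded n b cs P = count (event? cs P) Ω * ((2 ^ r) ^ length cs * 2 ^ n * β ^ b) ≤ N * (β ^ b + 2 ^ n)

  bounded-leaf : ∀ n b {cs P} → Valid cs P → 2 ^ n * β ^ b ≤ β ^ b + 2 ^ n → Bounded n b cs P
  bounded-leaf n b {cs} {P} v small = begin
    cnt * ((2 ^ r) ^ length cs * 2 ^ n * β ^ b)     ≡⟨ arrange cnt ((2 ^ r) ^ length cs) (2 ^ n) (β ^ b) ⟩
    cnt * (2 ^ r) ^ length cs * (2 ^ n * β ^ b)     ≤⟨ *-mono-≤ (count-event-≤ v) small ⟩
    N * (β ^ b + 2 ^ n)                             ∎
    where
    cnt = count (event? cs P) Ω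
    arrange : ∀ x y z w → x * (y * z * w) ≡ x * y * (z * w)
    arrange = solve-∀

  -- The sum bounded by `Q` counts the constraints made and those still to come, `M` for a good step
  -- and one for a bad step, so that `few-bad` applies at any time. A good step lowers `n`, a bad
  -- step lowers `b`, and a vertex of depth 0 is dropped from `P`.
  explore : ∀ n b cs P → Valid cs P → length cs + M * n + b ≤ Q → suc c * b + 2 ≤ M → Lasting b n P →
            Bounded n b cs P
  explore zero b cs P v small M≥ last = bounded-leaf 0 b v (begin
    1 * β ^ b            ≡⟨ *-identityˡ _ ⟩
    β ^ b                ≤⟨ m≤m+n _ 1 ⟩
    β ^ b + 1            ∎)
  explore n@(suc _) zero cs P v small M≥ last = bounded-leaf n 0 v (begin
    2 ^ n * 1            ≡⟨ *-identityʳ _ ⟩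
    2 ^ n                ≤⟨ m≤n+m _ 1 ⟩
    1 + 2 ^ n            ∎)
  -- With nothing pending the weight is 0, contrary to `suc n` vertices being left.
  explore (suc n) (suc b) cs [] v small M≥ last = ⊥-elim (n≮0 {n} (last [] z≤n))
  explore (suc n) (suc b) cs ((z , σ , zero) ∷ P) (valid tri (_ ∷ fr) (_ ∷ ap)) small M≥ last = ≤-trans
    (*-monoˡ-≤ _ (count-mono (event? cs ((z , σ , zero) ∷ P)) (event? cs P) (λ { H (nb , st , _ ∷ rP) → nb , st , rP }) Ω))
    (explore (suc n) (suc b) cs P (valid tri fr ap) small M≥ (lasting-skip {q = z , σ , zero} refl last))
  explore (suc n) (suc b) cs P₀@((z , σ , suc j) ∷ P) v small M≥ last =
    step-bound {2 ^ r} {(2 ^ r) ^ M} {{2^r≢0}} {{m^n≢0 (2 ^ r) M}}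
      (count (event? cs P₀) Ω)
      (∑ (badOptions cs z) (λ x → count (badEvent? x) Ω)) (∑ (goodOptions cs) (λ zs → count (goodEvent? zs) Ω))
      (length (badOptions cs z)) (length (goodOptions cs)) ((2 ^ r) ^ length cs) N β (β ^ b) (2 ^ n) 1≤β
      cover bad-sum good-sum bad-few good-few
    where
    badEvent? : ∀ x → Decidable (Event ((side σ , z , x) ∷ cs) (remaining x P))
    badEvent? x = event? _ _
    goodEvent? : ∀ zs → Decidable (Event (children z σ zs cs) (pendings (not σ) j zs P))
    goodEvent? zs = event? _ _
    cover : count (event? cs P₀) Ω ≤ ∑ (badOptions cs z) (λ x → count (badEvent? x) Ω) +
                                     ∑ (goodOptions cs) (λ zs → count (goodEvent? zs) Ω)
    cover = begin
      count (event? cs P₀) Ω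
        ≤⟨ ∑-mono Ω (λ H → ind-≤ (event? cs P₀ H) λ ev → [ H ]cover (step enough 1≤ v ev)) ⟩
      ∑ Ω (λ H → count (λ x → badEvent? x H) (badOptions cs z) + count (λ zs → goodEvent? zs H) (goodOptions cs))
        ≡⟨ ∑-distrib-+ Ω _ _ ⟩
      ∑ Ω (λ H → count (λ x → badEvent? x H) (badOptions cs z)) + ∑ Ω (λ H → count (λ zs → goodEvent? zs H) (goodOptions cs))
        ≡⟨ cong₂ _+_ (∑-swap Ω (badOptions cs z) (λ H x → ind (badEvent? x H)))
                     (∑-swap Ω (goodOptions cs) (λ H zs → ind (goodEvent? zs H))) ⟩
      ∑ (badOptions cs z) (λ x → count (badEvent? x) Ω) + ∑ (goodOptions cs) (λ zs → count (goodEvent? zs) Ω) ∎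
      where
      [_]cover : ∀ H → _ → 1 ≤ count (λ x → badEvent? x H) (badOptions cs z) + count (λ zs → goodEvent? zs H) (goodOptions cs)
      [ H ]cover (inj₁ (x , x∈ , ev))   = ≤-trans (count-some (λ x → badEvent? x H) x∈ ev) (m≤m+n _ _)
      [ H ]cover (inj₂ (zs , zs∈ , ev)) = ≤-trans (count-some (λ zs → goodEvent? zs H) zs∈ ev) (m≤n+m _ _)
    bad-sum : ∑ (badOptions cs z) (λ x → count (badEvent? x) Ω) * (2 ^ r * (2 ^ r) ^ length cs * (2 * 2 ^ n) * β ^ b)
              ≤ length (badOptions cs z) * (N * (β ^ b + 2 * 2 ^ n))
    bad-sum = ≤-trans (≤-reflexive (∑-*ʳ (badOptions cs z) _ _)) (∑-≤-length* (badOptions cs z) _ (All.tabulate λ {x} x∈ →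
      explore (suc n) b ((side σ , z , x) ∷ cs) (remaining x P)
        (bad-valid v (proj₂ (∈-filter⁻ (¬? ∘ meets? z) {xs = concatMap meeting (keys cs)} x∈)))
        (≤-trans (≤-reflexive (sym (+-suc _ b))) small)
        (≤-trans (+-monoˡ-≤ 2 (*-monoʳ-≤ (suc c) (n≤1+n b))) M≥)
        (lasting-bad x (length-remaining x (valid (Valid.triangular v) (All.tail (Valid.freshness v)) (AllPairs.tail (Valid.apart v)))) last)))
    good-sum : ∑ (goodOptions cs) (λ zs → count (goodEvent? zs) Ω) * ((2 ^ r) ^ M * (2 ^ r) ^ length cs * 2 ^ n * (β * β ^ b))
               ≤ length (goodOptions cs) * (N * (β * β ^ b + 2 ^ n))
    good-sum = ≤-trans (≤-reflexive (∑-*ʳ (goodOptions cs) _ _)) (∑-≤-length* (goodOptions cs) _ (All.tabulate λ {zs} zs∈ →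
      let (zs∈C , lights , apart , clear) = ∈-filter⁻ (suitable? cs) {xs = choose M X} zs∈
          (zs⊆X , len)                    = ∈-choose⁻ M zs∈C
          len-cs : length (children z σ zs cs) ≡ M + length cs
          len-cs = trans (length-++ (map (λ y → side σ , y , z) zs)) (cong (_+ length cs) (trans (length-map _ zs) len))
      in ≤-trans (≤-reflexive (cong (λ p → count (goodEvent? zs) Ω * (p * 2 ^ n * (β * β ^ b)))
             (trans (sym (^-distribˡ-+-* (2 ^ r) M (length cs))) (cong ((2 ^ r) ^_) (sym len-cs)))))
           (explore n (suc b) (children z σ zs cs) (pendings (not σ) j zs P)
             (good-valid v zs⊆X lights apart clear)
             (≤-trans (≤-reflexive (trans (cong (λ l → l + M * n + suc b) len-cs) (arrange M (length cs) n (suc b)))) small)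
             M≥
             (lasting-good (≤-trans M≥ (≤-reflexive (sym len))) last))))
      where
      arrange : ∀ M l n b → (M + l) + M * n + b ≡ l + M * (1 + n) + b
      arrange = solve-∀
    bad-few : 4 * length (badOptions cs z) * β ≤ 2 ^ r
    bad-few = ≤-trans (*-monoˡ-≤ β (*-monoʳ-≤ 4 (≤-trans (length-badOptions cs z)
      (*-monoˡ-≤ (c * θ) (*-monoʳ-≤ 2 (≤-trans (≤-trans (m≤m+n (length cs) (M * suc n)) (m≤m+n _ (suc b))) small)))))) few-bad
    good-few : 4 * length (goodOptions cs) ≤ (2 ^ r) ^ M
    good-few = ≤-trans (*-monoʳ-≤ 4 (List.length-filter (suitable? cs) (choose M X))) few-good

  apart⇒peelable : ∀ {zs} → All HasLight zs → Apart zs → Peelable zs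
  apart⇒peelable []                   []        = []
  apart⇒peelable {z ∷ zs} ((p , light) ∷ ls) (z# ∷ ap) =
    uncovered p (λ cov → let (y , y∈ , eq) = find cov in All.lookup z# y∈ (meet (light , sym eq))) (apart⇒peelable ls ap)

  ∈-keys-chain : ∀ {σ y} x zs → y ∈ x ∷ zs → 1 ≤ length zs → y ∈ keys (chain σ (x ∷ zs))
  ∈-keys-chain x (z ∷ zs)     (here refl)         _ = here refl
  ∈-keys-chain x (z ∷ zs)     (there (here refl)) _ = there (here refl)
  ∈-keys-chain x (z ∷ w ∷ zs) (there (there y∈))  _ = there (there (∈-keys-chain z (w ∷ zs) (there y∈) (s≤s z≤n)))

  chain-untouched : ∀ {y} zs → All (Untouched y true) (chain (side false) zs)
  chain-untouched []           = []
  chain-untouched (x ∷ [])     = []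
  chain-untouched (x ∷ z ∷ zs) = (λ eq → ⊥-elim (sides-differ eq)) ∷ chain-untouched (z ∷ zs)

  root-valid : ∀ {k zs} → zs ⊆ X → All HasLight zs → Apart zs → 2 ≤ length zs →
               Valid (chain (side false) zs) (pendings true k zs [])
  root-valid {k} {x ∷ zs} zs⊆X lights apart (s≤s 1≤zs) =
    valid (chain-triangular (side false) (apart⇒peelable lights apart))
      (All.++⁺ (All.map⁺ (All.tabulate λ {y} y∈ → fresh (All.lookup lights y∈) (Any-resp-⊆ zs⊆X y∈)
         (∈-keys-chain x zs y∈ 1≤zs) (chain-untouched (x ∷ zs)))) [])
      (pendings-apart apart [] (All.tabulate λ _ → []))

  lasting-root : ∀ {b n k} zs → suc c * b + 2 ≤ length zs → n ≤ nodes k → Lasting b n (pendings true k zs [])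
  lasting-root {b} {n} {k} zs M≥ n≤ {Q} Q⊆ len with ⊆-++-split (map (λ y → y , true , k) zs) Q⊆
  ... | us , .[] , refl , us⊆ , [] = begin
    n                       ≤⟨ n≤ ⟩
    nodes k                 ≡⟨ *-identityˡ (nodes k) ⟨
    1 * nodes k             ≤⟨ *-monoˡ-≤ (nodes k) 1≤us ⟩
    length us * nodes k     ≡⟨ pendings-level zs us⊆ ⟨
    weight us               ≡⟨ cong weight (List.++-identityʳ us) ⟨
    weight (us ++ [])       ∎
    where
    1≤us : 1 ≤ length us
    1≤us = +-cancelˡ-≤ (suc c * b) _ _ (begin
      suc c * b + 1                                            ≤⟨ +-monoʳ-≤ (suc c * b) (n≤1+n 1) ⟩
      suc c * b + 2                                            ≤⟨ M≥ ⟩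
      length zs                                                ≡⟨ length-map (λ y → y , true , k) zs ⟨
      length (map (λ y → y , true , k) zs)                     ≡⟨ cong length (List.++-identityʳ (map (λ y → y , true , k) zs)) ⟨
      length (pendings true k zs [])                           ≤⟨ len ⟩
      length (us ++ []) + suc c * b                            ≡⟨ cong (λ l → length l + suc c * b) (List.++-identityʳ us) ⟩
      length us + suc c * b                                    ≡⟨ +-comm (length us) _ ⟩
      suc c * b + length us                                    ∎)

  Surprise : ℕ → Tabulations d c s r → Set
  Surprise k H = ¬ Bad H × Rooted k H

  surprise? : ∀ k → Decidable (Surprise k)
  surprise? k H = ¬? (bad? H) ×-dec rooted? k H

  -- The factor `2 ^ r` on the right stands for the hash value of the root: its `M` edges give only
  -- `pred M` constraints.
  count-surprise : ∀ k n b → n ≤ nodes k → M + M * n + b ≤ Q → suc c * b + 2 ≤ M →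
                   count (surprise? k) Ω * (2 ^ n * β ^ b) ≤ 2 ^ r * (N * (β ^ b + 2 ^ n))
  count-surprise k n b n≤ small M≥ = *-cancelˡ-≤ ((2 ^ r) ^ M) {{m^n≢0 (2 ^ r) M}} (begin
    (2 ^ r) ^ M * (cnt * (2 ^ n * β ^ b))                          ≡⟨ cong (λ m → (2 ^ r) ^ m * (cnt * (2 ^ n * β ^ b))) M≡ ⟨
    2 ^ r * (2 ^ r) ^ pred M * (cnt * (2 ^ n * β ^ b))             ≡⟨ arrange (2 ^ r) ((2 ^ r) ^ pred M) cnt (2 ^ n) (β ^ b) ⟩
    2 ^ r * (cnt * ((2 ^ r) ^ pred M * 2 ^ n * β ^ b))             ≤⟨ *-monoʳ-≤ (2 ^ r) root-sum ⟩
    2 ^ r * (length (goodOptions []) * (N * (β ^ b + 2 ^ n)))      ≤⟨ *-monoʳ-≤ (2 ^ r) (*-monoˡ-≤ _ (≤-trans (m≤m+n (length (goodOptions [])) _) few)) ⟩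
    2 ^ r * ((2 ^ r) ^ M * (N * (β ^ b + 2 ^ n)))                  ≡⟨ x∙yz≈y∙xz (2 ^ r) ((2 ^ r) ^ M) _ ⟩
    (2 ^ r) ^ M * (2 ^ r * (N * (β ^ b + 2 ^ n)))                  ∎)
    where
    cnt = count (surprise? k) Ω
    few : 4 * length (goodOptions []) ≤ (2 ^ r) ^ M
    few = ≤-trans (*-monoʳ-≤ 4 (List.length-filter (suitable? []) (choose M X))) few-good
    M≥2 : 2 ≤ M
    M≥2 = ≤-trans (m≤n+m 2 _) M≥
    M≡ : suc (pred M) ≡ M
    M≡ = suc-pred M {{>-nonZero (≤-trans (s≤s z≤n) M≥2)}}
    arrange : ∀ R P x y z → R * P * (x * (y * z)) ≡ R * (x * (P * y * z))
    arrange = solve-∀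
    rootEvent? : ∀ zs → Decidable (Event (chain (side false) zs) (pendings true k zs []))
    rootEvent? zs = event? _ _
    find-root : ∀ {H} → Surprise k H → ∃[ zs ] zs ∈ goodOptions [] × Event (chain (side false) zs) (pendings true k zs []) H
    find-root {H} (¬bad , rooted) =
      let (x , _ , rich-x)                    = find rooted
          (ys , cl , lights , long , branches) = rich-pick enough 1≤ {H} {k} {false} ¬bad rich-x
          (zs , zs⊆ , len , apart) = pick M ¬bad cl lights 1≤ (≤-trans (m≤n+m _ (c * e ^ c)) long)
      in zs , ∈-filter⁺ (suitable? []) (subst (λ m → zs ∈ choose m X) len (∈-choose (⊆-trans zs⊆ (Cluster.⊆X cl))))
                (All-resp-⊆ zs⊆ lights , apart , All.tabulate λ _ → []) ,
         ¬bad , sat-chain (side false) H _ (All-resp-⊆ zs⊆ (Cluster.same cl)) ,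
         All.++⁺ (All.map⁺ (All.map proj₂ (All-resp-⊆ zs⊆ branches))) []
    length-chain′ : ∀ {zs} → length zs ≡ M → length (chain (side false) zs) ≡ pred M
    length-chain′ {[]}     len = cong pred len
    length-chain′ {x ∷ zs} len = trans (length-chain (side false) x zs) (cong pred len)
    root-sum : cnt * ((2 ^ r) ^ pred M * 2 ^ n * β ^ b) ≤ length (goodOptions []) * (N * (β ^ b + 2 ^ n))
    root-sum = begin
      cnt * W                                                             ≤⟨ *-monoˡ-≤ W cover ⟩
      ∑ (goodOptions []) (λ zs → count (rootEvent? zs) Ω) * W             ≡⟨ ∑-*ʳ (goodOptions []) _ W ⟩
      ∑ (goodOptions []) (λ zs → count (rootEvent? zs) Ω * W)             ≤⟨ ∑-≤-length* (goodOptions []) _ (All.tabulate one) ⟩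
      length (goodOptions []) * (N * (β ^ b + 2 ^ n))                     ∎
      where
      W = (2 ^ r) ^ pred M * 2 ^ n * β ^ b
      cover : cnt ≤ ∑ (goodOptions []) (λ zs → count (rootEvent? zs) Ω)
      cover = ≤-trans
        (∑-mono Ω λ H → ind-≤ (surprise? k H) λ sp → let (zs , zs∈ , ev) = find-root {H} sp in
           count-some (λ zs → rootEvent? zs H) zs∈ ev)
        (≤-reflexive (∑-swap Ω (goodOptions []) (λ H zs → ind (rootEvent? zs H))))
      one : ∀ {zs} → zs ∈ goodOptions [] → count (rootEvent? zs) Ω * W ≤ N * (β ^ b + 2 ^ n)
      one {zs} zs∈ =
        let (zs∈C , lights , apart , _) = ∈-filter⁻ (suitable? []) {xs = choose M X} zs∈
            (zs⊆X , len)                = ∈-choose⁻ M zs∈C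
        in subst (λ m → count (rootEvent? zs) Ω * ((2 ^ r) ^ m * 2 ^ n * β ^ b) ≤ N * (β ^ b + 2 ^ n)) (length-chain′ {zs} len)
             (explore n b (chain (side false) zs) (pendings true k zs [])
               (root-valid zs⊆X lights apart (≤-trans M≥2 (≤-reflexive (sym len))))
               (≤-trans (+-monoˡ-≤ b (+-monoˡ-≤ (M * n) (≤-trans (≤-reflexive (length-chain′ {zs} len)) pred[n]≤n))) small)
               M≥
               (lasting-root zs (≤-trans M≥ (≤-reflexive (sym len))) n≤))

-- The number of keys without light characters

∑-⊆ : ∀ {xs ys : List A} f → xs ⊆ ys → ∑ xs f ≤ ∑ ys f
∑-⊆ f []            = z≤n
∑-⊆ f (y ∷ʳ xs⊆)    = ≤-trans (∑-⊆ f xs⊆) (m≤n+m _ (f y))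
∑-⊆ f (refl ∷ xs⊆)  = +-monoʳ-≤ _ (∑-⊆ f xs⊆)

∑-≥-length* : ∀ (xs : List A) {f} k → All (λ x → k ≤ f x) xs → length xs * k ≤ ∑ xs f
∑-≥-length* []       k []       = z≤n
∑-≥-length* (x ∷ xs) k (p ∷ ps) = +-mono-≤ p (∑-≥-length* xs k ps)

module DullKeys (c s : ℕ) (X : List (Key c s)) (X! : Unique X) (θ : ℕ) .{{_ : NonZero θ}} where
  open Keys c s X θ
  open Peeling c s using (keyEq?)

  heavy : Fin c → List (Fin s)
  heavy p = filter (¬? ∘ light? p) (allFin s)

  length-heavy : ∀ h p → length X ≤ h * θ → length (heavy p) ≤ h
  length-heavy h p X≤ = *-cancelʳ-≤ _ _ θ (begin
    length (heavy p) * θ                                          ≤⟨ ∑-≥-length* (heavy p) θ (All.map (<⇒≤ ∘ ≰⇒>) (All.all-filter (¬? ∘ light? p) (allFin s))) ⟩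
    ∑ (heavy p) (λ t → count (λ x → lookup x p Fin.≟ t) X)        ≡⟨ ∑-swap (heavy p) X (λ t x → ind (lookup x p Fin.≟ t)) ⟩
    ∑ X (λ x → count (λ t → lookup x p Fin.≟ t) (heavy p))        ≤⟨ ∑-≤-length* X 1 (All.tabulate λ {x} _ →
                                                                       count-unique≤1 (lookup x p Fin.≟_) (Unique.filter⁺ (¬? ∘ light? p) (Unique.allFin⁺ s))
                                                                         (λ e e′ → trans (sym e) e′)) ⟩
    length X * 1                                                  ≡⟨ *-identityʳ _ ⟩
    length X                                                      ≤⟨ X≤ ⟩
    h * θ                                                         ∎)
    where open ≤-Reasoning

  -- A dull key has a heavy character at each position, and by double counting a position has at
  -- most `h` of these.
  length-dull : ∀ h → length X ≤ h * θ → length dull ≤ h ^ c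
  length-dull h X≤ = ≤-trans
    (unique-⊆⇒length≤ keyEq? (Unique.filter⁺ (¬? ∘ hasLight?) X!) (All.map (λ {x} ¬light →
      ∈-candidates {ls = heavy} x λ p → ∈-filter⁺ (¬? ∘ light? p) (∈-allFin (lookup x p)) (λ l → ¬light (p , l)))
      (All.all-filter (¬? ∘ hasLight?) X)))
    (length-candidates heavy h (λ p → length-heavy h p X≤))

-- Allocations

module Allocations (d c s r : ℕ) (side : Bool → Fin d) (sides-differ : side false ≢ side true)
  (X : List (Key c s)) (X! : Unique X) (θ e : ℕ) (L M : ℕ) (H : Tabulations d c s r) where
  open Exploration d c s r side sides-differ X X! θ e L M

  load-∷ : ∀ b b′ (bs : List (Bin d r)) → load (b′ ∷ bs) b ≡ ind (b ≟ b′) + load bs b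
  load-∷ b b′ bs with b ≟ b′
  ... | yes _ = refl
  ... | no _  = refl

  RichAbove : ℕ → Set
  RichAbove j = ∀ {xs bs σ v} → Allocation H xs bs → xs ⊆ X → j * L ≤ load bs (v , side σ) → T (rich H j σ v)

  -- The keys that arrive in a bin when it holds j * L keys or more are branches.
  load-≤-branches : ∀ {j} → RichAbove j → ∀ {xs bs} σ v → Allocation H xs bs → xs ⊆ X →
                    load bs (v , side σ) ≤ j * L + count (branch? H j σ v) xs
  load-≤-branches ih σ v empty xs⊆ = z≤n
  load-≤-branches {j} ih {x ∷ xs} {_ ∷ bs} σ v (insert al i minimal) xs⊆ = begin
    load (bin H x i ∷ bs) b                                    ≡⟨ load-∷ b (bin H x i) bs ⟩
    ind (b ≟ bin H x i) + load bs b                            ≤⟨ by-cases (b ≟ bin H x i) (j * L ≤? load bs b) ⟩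
    j * L + (ind (branch? H j σ v x) + count (branch? H j σ v) xs) ∎
    where
    open ≤-Reasoning
    b = v , side σ
    xs⊆X = ⊆-trans (x ∷ʳ ⊆-refl) xs⊆
    rest : load bs b ≤ j * L + count (branch? H j σ v) xs
    rest = load-≤-branches {j} ih σ v al xs⊆X
    by-cases : (b≟ : Dec (b ≡ bin H x i)) → Dec (j * L ≤ load bs b) →
               ind b≟ + load bs b ≤ j * L + (ind (branch? H j σ v x) + count (branch? H j σ v) xs)
    by-cases (no _)     _         = ≤-trans rest (+-monoʳ-≤ (j * L) (m≤n+m _ _))
    by-cases (yes _)    (no low)  = ≤-trans (≰⇒> low) (m≤m+n _ _)
    by-cases (yes refl) (yes high) = begin
      suc (load bs b)                                          ≤⟨ s≤s rest ⟩
      suc (j * L + count (branch? H j σ v) xs)                 ≡⟨ +-suc (j * L) _ ⟨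
      j * L + suc (count (branch? H j σ v) xs)                 ≡⟨ cong (λ k → j * L + (k + count (branch? H j σ v) xs)) (ind-yes (branch? H j σ v x)
                                                                    (refl , ih al xs⊆X (≤-trans high (minimal (side (not σ)))))) ⟨
      j * L + (ind (branch? H j σ v x) + count (branch? H j σ v) xs) ∎

  rich-load : ∀ j → RichAbove j
  rich-load zero    al xs⊆ high = tt
  rich-load (suc j) {xs} {bs} {σ} {v} al xs⊆ high = ≤⇒≤ᵇ (+-cancelˡ-≤ (j * L) _ _ (begin
    j * L + L                                      ≡⟨ +-comm (j * L) L ⟩
    L + j * L                                      ≤⟨ high ⟩
    load bs (v , side σ)                           ≤⟨ load-≤-branches {j} (rich-load j) σ v al xs⊆ ⟩
    j * L + count (branch? H j σ v) xs             ≤⟨ +-monoʳ-≤ (j * L) (∑-⊆ _ xs⊆) ⟩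
    j * L + count (branch? H j σ v) X              ≡⟨ cong (j * L +_) (length-filter≡count (branch? H j σ v) X) ⟨
    j * L + length (filter (branch? H j σ v) X)    ∎))
    where open ≤-Reasoning

  -- It suffices to look at one table: a key placed in any of the `d` tables found its bin in
  -- `side false` at least as full. Were the load `k * L` already, that bin would make the key's end
  -- there rich.
  load-bound : ∀ k → (∀ {x} → x ∈ X → ¬ T (rich H k false (H ⟨ side false ⟩ x))) →
               ∀ {xs bs} → Allocation H xs bs → xs ⊆ X → ∀ b → load bs b ≤ k * L
  load-bound k poor empty xs⊆ b = z≤n
  load-bound k poor {x ∷ xs} {_ ∷ bs} (insert al i minimal) xs⊆ b =
    ≤-trans (≤-reflexive (load-∷ b (bin H x i) bs)) (by-cases (b ≟ bin H x i))
    where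
    xs⊆X = ⊆-trans (x ∷ʳ ⊆-refl) xs⊆
    by-cases : (b≟ : Dec (b ≡ bin H x i)) → ind b≟ + load bs b ≤ k * L
    by-cases (no _)     = load-bound k poor al xs⊆X b
    by-cases (yes refl) = ≰⇒> λ high → poor (Any-resp-⊆ xs⊆ (here refl))
      (rich-load k al xs⊆X (≤-trans high (minimal (side false))))

  maxLoad-bound : ∀ k → (∀ {x} → x ∈ X → ¬ T (rich H k false (H ⟨ side false ⟩ x))) →
                  ∀ {bs} → Allocation H X bs → maxLoad bs ≤ k * L
  maxLoad-bound k poor {bs} al = max≤v⁺ z≤n
    (All.map⁺ (All.tabulate {xs = allBins d r} λ {b} _ → load-bound k poor al ⊆-refl b))

-- The choice of constants

^-distribʳ-* : ∀ n x y → (x * y) ^ n ≡ x ^ n * y ^ n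
^-distribʳ-* zero    x y = refl
^-distribʳ-* (suc n) x y = trans (cong (x * y *_) (^-distribʳ-* n x y)) (arrange x y (x ^ n) (y ^ n))
  where
  arrange : ∀ x y u v → x * y * (u * v) ≡ x * u * (y * v)
  arrange = solve-∀

1+n≤2^n : ∀ n → suc n ≤ 2 ^ n
1+n≤2^n zero    = ≤-refl
1+n≤2^n (suc n) = begin
  1 + suc n             ≤⟨ +-mono-≤ (m^n>0 2 n) (1+n≤2^n n) ⟩
  2 ^ n + 2 ^ n         ≡⟨ cong (2 ^ n +_) (+-identityʳ _) ⟨
  2 ^ suc n             ∎
  where open ≤-Reasoning

-- With `u = w / 2`, one factor `suc u ≤ 2 ^ u` absorbs `2 * a` and the other one half of `suc w`.
linear≤2^ : ∀ a w → 4 * a ≤ w → a * suc w ≤ 2 ^ w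
linear≤2^ a w 4a≤w = begin
  a * suc w                         ≤⟨ *-monoʳ-≤ a w< ⟩
  a * (2 * suc u)                   ≡⟨ arrange a (suc u) ⟩
  2 * a * suc u                     ≤⟨ *-monoˡ-≤ (suc u) 2a≤ ⟩
  suc u * suc u                     ≤⟨ *-mono-≤ (1+n≤2^n u) (1+n≤2^n u) ⟩
  2 ^ u * 2 ^ u                     ≡⟨ ^-distribˡ-+-* 2 u u ⟨
  2 ^ (u + u)                       ≤⟨ ^-monoʳ-≤ 2 (≤-trans (≤-reflexive (u+u u)) (m/n*n≤m w 2)) ⟩
  2 ^ w                             ∎
  where
  open ≤-Reasoning
  u = w / 2
  arrange : ∀ a u → a * (2 * u) ≡ 2 * a * u
  arrange = solve-∀
  u+u : ∀ u → u + u ≡ u * 2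
  u+u = solve-∀
  w< : suc w ≤ 2 * suc u
  w< = begin
    suc w                        ≡⟨ cong suc (m≡m%n+[m/n]*n w 2) ⟩
    suc (w % 2) + u * 2          ≤⟨ +-monoˡ-≤ (u * 2) (m%n<n w 2) ⟩
    2 + u * 2                    ≡⟨ *-comm (suc u) 2 ⟩
    2 * suc u                    ∎
  2a≤ : 2 * a ≤ suc u
  2a≤ = *-cancelˡ-≤ 2 (≤-trans (≤-trans (≤-reflexive (four a)) 4a≤w) (≤-trans (n≤1+n w) w<))
    where
    four : ∀ a → 2 * (2 * a) ≡ 4 * a
    four = solve-∀

q^j≤[q+j]! : ∀ q j → q ^ j ≤ (q + j) !
q^j≤[q+j]! q zero    = n!>0′ (q + 0)
  where
  n!>0′ : ∀ n → 1 ≤ n !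
  n!>0′ zero    = ≤-refl
  n!>0′ (suc n) = *-mono-≤ (s≤s (z≤n {n})) (n!>0′ n)
q^j≤[q+j]! q (suc j) = begin
  q * q ^ j                     ≤⟨ *-mono-≤ (≤-trans (m≤m+n q j) (n≤1+n _)) (q^j≤[q+j]! q j) ⟩
  suc (q + j) * (q + j) !       ≡⟨ cong _! (+-suc q j) ⟨
  (q + suc j) !                 ∎
  where open ≤-Reasoning

-- The upper half of the factors of `(q + q) !` exceed `q`, and each of them pays for `4 * (D * D)`.
4D^2q≤[2q]! : ∀ D q → 4 * (D * D) ≤ q → 1 ≤ q → 4 * D ^ (q + q) ≤ (q + q) !
4D^2q≤[2q]! D q large 1≤q = begin
  4 * D ^ (q + q)               ≡⟨ cong (4 *_) (trans (^-distribˡ-+-* D q q) (sym (^-distribʳ-* q D D))) ⟩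
  4 * (D * D) ^ q               ≤⟨ *-monoˡ-≤ ((D * D) ^ q) (≤-trans (≤-reflexive (sym (^-identityʳ 4))) (^-monoʳ-≤ 4 1≤q)) ⟩
  4 ^ q * (D * D) ^ q           ≡⟨ ^-distribʳ-* q 4 (D * D) ⟨
  (4 * (D * D)) ^ q             ≤⟨ ^-monoˡ-≤ q large ⟩
  q ^ q                         ≤⟨ q^j≤[q+j]! q q ⟩
  (q + q) !                     ∎
  where open ≤-Reasoning

-- The logarithm is that of `suc m`, which also makes sense for `m = 0`.
floor-log : ∀ m → ∃[ l ] 2 ^ l ≤ suc m × suc m < 2 ^ suc l
floor-log zero    = 0 , ≤-refl , ≤-refl
floor-log (suc m) with floor-log m
... | l , lower , upper with suc (suc m) <? 2 ^ suc l
... | yes below = l , m≤n⇒m≤1+n lower , below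
... | no ¬below = suc l , ≮⇒≥ ¬below , (begin-strict
  suc (suc m)                       ≤⟨ upper ⟩
  2 ^ suc l                         <⟨ m<m+n (2 ^ suc l) (m^n>0 2 (suc l)) ⟩
  2 ^ suc l + 2 ^ suc l             ≡⟨ cong (2 ^ suc l +_) (+-identityʳ _) ⟨
  2 ^ suc (suc l)                   ∎)
  where open ≤-Reasoning

nodes-2^ : ∀ k → suc (nodes k) ≡ 2 ^ k
nodes-2^ zero    = refl
nodes-2^ (suc k) = trans (lemma (nodes k)) (cong (2 *_) (nodes-2^ k))
  where
  lemma : ∀ n → 2 + (n + n) ≡ 2 * (1 + n)
  lemma = solve-∀

-- D bounds the number of keys per value of one hash function, and n ^ -g is the
-- failure probability to be reached.
module Parameters (d c D g : ℕ) .{{_ : NonZero c}} (2≤c : 2 ≤ c) (1≤D : 1 ≤ D) where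
  open ≤-Reasoning

  instance
    4c≢0 : NonZero (4 * c)
    4c≢0 = m*n≢0 4 c

  -- M ! ≥ 4 D ^ M makes good steps rare, and M ≥ (c + 1) budget + 2 leaves every
  -- explored vertex two children.
  g⁺ e budget q M L slope : ℕ
  -- `bad-part` spends two powers of `2 ^ r`, one on the number of tests and one on the constraint
  -- that a chain lacks. Since `r ≤ 8 * c * w r`, the values of `e` and `budget` make
  -- `(2 ^ (2 * w r)) ^ e` and `(2 ^ w r) ^ budget` reach `(2 ^ r) ^ g⁺`.
  g⁺     = g + 2
  e      = 4 * c * g⁺
  budget = 8 * c * g⁺
  q      = 4 * (D * D) + (suc c * budget + 2)
  M      = q + q
  L      = e ^ c + c * e ^ c + M * (c * e ^ c)
  -- One factor `8 * c` comes from `few-bad`, the other from `suc r ≤ 8 * c * suc (w r)`; together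
  -- they bound `8 * c * Q r` by `slope * suc (w r)`.
  slope  = 64 * (c * c) * (M + M * g⁺ + budget)

  -- The divisor `4 * c` in `w` ensures `2 * w r * (c + 1) ≤ r`, so that the dull keys, at most a
  -- constant times `(2 ^ (2 * w r)) ^ c`, number no more than a constant times `θ r`. A binary tree
  -- of depth `depth r` has the `g⁺ * r` inner nodes whose exploration has probability of order
  -- `(2 ^ r) ^ -g⁺`.
  w θ depth Q : ℕ → ℕ
  w r     = r / (4 * c)
  θ r     = 2 ^ (r ∸ 2 * w r)
  depth r = proj₁ (floor-log r) + suc g⁺
  Q r     = M + M * (g⁺ * r) + budget

  1≤ : 1 ≤ c * e ^ c
  1≤ = *-mono-≤ (≤-trans (s≤s z≤n) 2≤c) (m^n>0 e {{m*n≢0 (4 * c) g⁺ {{4c≢0}} {{g⁺≢0}}}} c)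
    where
    g⁺≢0 : NonZero g⁺
    g⁺≢0 = >-nonZero (≤-trans (s≤s z≤n) (m≤n+m 2 g))

  4cw≤r : ∀ r → w r * (4 * c) ≤ r
  4cw≤r r = m/n*n≤m r (4 * c)

  r<4c[w+1] : ∀ r → r < 4 * c * suc (w r)
  r<4c[w+1] r = begin-strict
    r                                       ≡⟨ m≡m%n+[m/n]*n r (4 * c) ⟩
    r % (4 * c) + w r * (4 * c)             <⟨ +-monoˡ-< _ (m%n<n r (4 * c)) ⟩
    4 * c + w r * (4 * c)                   ≡⟨ *-comm (suc (w r)) (4 * c) ⟩
    4 * c * suc (w r)                       ∎

  2w≤r : ∀ r → 2 * w r ≤ r
  2w≤r r = begin
    2 * w r              ≤⟨ *-monoˡ-≤ (w r) (≤-trans (s≤s (s≤s z≤n)) (*-monoʳ-≤ 4 (≤-trans (s≤s (z≤n {1})) 2≤c))) ⟩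
    4 * c * w r          ≡⟨ *-comm (4 * c) (w r) ⟩
    w r * (4 * c)        ≤⟨ 4cw≤r r ⟩
    r                    ∎

  θ·2^2w : ∀ r → θ r * 2 ^ (2 * w r) ≡ 2 ^ r
  θ·2^2w r = trans (sym (^-distribˡ-+-* 2 (r ∸ 2 * w r) (2 * w r))) (cong (2 ^_) (m∸n+n≡m (2w≤r r)))

  g⁺r≤nodes : ∀ r → g⁺ * r ≤ nodes (depth r)
  g⁺r≤nodes r = s≤s⁻¹ (begin
    suc (g⁺ * r)                                         ≤⟨ s≤s (m≤m+n _ _) ⟩
    suc (g⁺ * r + (g⁺ + (r + 0)))                        ≡⟨ arrange g⁺ r ⟩
    suc r * suc g⁺                                       ≤⟨ *-mono-≤ (<⇒≤ (proj₂ (proj₂ (floor-log r)))) (1+n≤2^n g⁺) ⟩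
    2 ^ suc l * 2 ^ g⁺                                   ≡⟨ ^-distribˡ-+-* 2 (suc l) g⁺ ⟨
    2 ^ (suc l + g⁺)                                     ≡⟨ cong (2 ^_) (+-suc l g⁺) ⟨
    2 ^ depth r                                          ≡⟨ nodes-2^ (depth r) ⟨
    suc (nodes (depth r))                                ∎)
    where
    l = proj₁ (floor-log r)
    arrange : ∀ g r → 1 + (g * r + (g + (r + 0))) ≡ (1 + r) * (1 + g)
    arrange = solve-∀

  module Large (r : ℕ) (large : 4 * slope ≤ w r) where

    1≤w : 1 ≤ w r
    1≤w = ≤-trans (*-mono-≤ (s≤s (z≤n {3})) (*-mono-≤ (*-mono-≤ (s≤s (z≤n {63})) (*-mono-≤ 1≤c 1≤c)) (≤-trans (s≤s z≤n) 2≤sum))) large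
      where
      1≤c = ≤-trans (s≤s z≤n) 2≤c
      2≤sum : 2 ≤ M + M * g⁺ + budget
      2≤sum = begin
        2                        ≤⟨ m≤n+m 2 _ ⟩
        suc c * budget + 2            ≤⟨ m≤n+m _ (4 * (D * D)) ⟩
        q                        ≤⟨ m≤m+n q q ⟩
        M                        ≤⟨ m≤m+n M _ ⟩
        M + M * g⁺               ≤⟨ m≤m+n _ budget ⟩
        M + M * g⁺ + budget           ∎

    r≤8cw : r ≤ 8 * c * w r
    r≤8cw = begin
      r                          ≤⟨ <⇒≤ (r<4c[w+1] r) ⟩
      4 * c * suc (w r)          ≤⟨ *-monoʳ-≤ (4 * c) (+-monoˡ-≤ (w r) 1≤w) ⟩
      4 * c * (w r + w r)        ≡⟨ arrange c (w r) ⟩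
      8 * c * w r                ∎
      where
      arrange : ∀ c w → 4 * c * (w + w) ≡ 8 * c * w
      arrange = solve-∀

    -- The quotient of `2 ^ r` and `θ r` is `2 ^ w r` squared. One factor is `β`; the other
    -- outweighs the number of constraints, which is only linear in `r`.
    few-bad : 4 * (2 * Q r * (c * θ r)) * 2 ^ w r ≤ 2 ^ r
    few-bad = begin
      4 * (2 * Q r * (c * θ r)) * 2 ^ w r     ≡⟨ arrange₁ (Q r) c (θ r) (2 ^ w r) ⟩
      θ r * (8 * c * Q r * 2 ^ w r)           ≤⟨ *-monoʳ-≤ (θ r) (*-monoˡ-≤ (2 ^ w r) enough) ⟩
      θ r * (2 ^ w r * 2 ^ w r)               ≡⟨ cong (θ r *_) (trans (sym (^-distribˡ-+-* 2 (w r) (w r))) (cong (2 ^_) (cong (w r +_) (sym (+-identityʳ (w r)))))) ⟩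
      θ r * 2 ^ (2 * w r)                     ≡⟨ θ·2^2w r ⟩
      2 ^ r                                   ∎
      where
      arrange₁ : ∀ Q c θ b → 4 * (2 * Q * (c * θ)) * b ≡ θ * (8 * c * Q * b)
      arrange₁ = solve-∀
      arrange₂ : ∀ m budget g r → (m + m * g + budget) * (1 + r) ≡ m + m * (g * r) + budget + (m * g + budget * r + m * r)
      arrange₂ = solve-∀
      arrange₃ : ∀ c s w → 8 * c * (s * (8 * c * w)) ≡ 64 * (c * c) * s * w
      arrange₃ = solve-∀
      1+r≤ : suc r ≤ 8 * c * suc (w r)
      1+r≤ = begin
        suc r                     ≤⟨ r<4c[w+1] r ⟩
        4 * c * suc (w r)         ≤⟨ *-monoˡ-≤ (suc (w r)) (*-monoˡ-≤ c (m≤m+n 4 4)) ⟩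
        8 * c * suc (w r)         ∎
      enough : 8 * c * Q r ≤ 2 ^ w r
      enough = begin
        8 * c * Q r                                            ≤⟨ *-monoʳ-≤ (8 * c) (m≤m+n (Q r) _) ⟩
        8 * c * (Q r + (M * g⁺ + budget * r + M * r))               ≡⟨ cong (8 * c *_) (arrange₂ M budget g⁺ r) ⟨
        8 * c * ((M + M * g⁺ + budget) * suc r)                     ≤⟨ *-monoʳ-≤ (8 * c) (*-monoʳ-≤ (M + M * g⁺ + budget) 1+r≤) ⟩
        8 * c * ((M + M * g⁺ + budget) * (8 * c * suc (w r)))       ≡⟨ arrange₃ c (M + M * g⁺ + budget) (suc (w r)) ⟩
        slope * suc (w r)                                      ≤⟨ linear≤2^ slope (w r) large ⟩
        2 ^ w r                                                ∎

    R^g⁺≤β^budget : (2 ^ r) ^ g⁺ ≤ (2 ^ w r) ^ budget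
    R^g⁺≤β^budget = begin
      (2 ^ r) ^ g⁺                 ≡⟨ ^-*-assoc 2 r g⁺ ⟩
      2 ^ (r * g⁺)                 ≤⟨ ^-monoʳ-≤ 2 (≤-trans (*-monoˡ-≤ g⁺ r≤8cw) (≤-reflexive (arrange c (w r) g⁺))) ⟩
      2 ^ (w r * budget)                ≡⟨ ^-*-assoc 2 (w r) budget ⟨
      (2 ^ w r) ^ budget                ∎
      where
      arrange : ∀ c w g → 8 * c * w * g ≡ w * (8 * c * g)
      arrange = solve-∀

    R^g⁺≤2^2we : (2 ^ r) ^ g⁺ ≤ (2 ^ (2 * w r)) ^ suc e
    R^g⁺≤2^2we = begin
      (2 ^ r) ^ g⁺                 ≡⟨ ^-*-assoc 2 r g⁺ ⟩
      2 ^ (r * g⁺)                 ≤⟨ ^-monoʳ-≤ 2 (≤-trans (*-monoˡ-≤ g⁺ r≤8cw) (≤-trans (≤-reflexive (arrange c (w r) g⁺)) (*-monoʳ-≤ (2 * w r) (n≤1+n e)))) ⟩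
      2 ^ (2 * w r * suc e)        ≡⟨ ^-*-assoc 2 (2 * w r) (suc e) ⟨
      (2 ^ (2 * w r)) ^ suc e      ∎
      where
      arrange : ∀ c w g → 8 * c * w * g ≡ 2 * w * (4 * c * g)
      arrange = solve-∀

  few-good : ∀ r {s} (X : List (Key c s)) → length X ≤ D * 2 ^ r → 4 * length (choose M X) ≤ (2 ^ r) ^ M
  few-good r X X≤ = *-cancelˡ-≤ (D ^ M) {{m^n≢0 D M {{>-nonZero 1≤D}}}} (begin
    D ^ M * (4 * length (choose M X))       ≡⟨ arrange (D ^ M) (length (choose M X)) ⟩
    length (choose M X) * (4 * D ^ M)       ≤⟨ *-monoʳ-≤ (length (choose M X)) (4D^2q≤[2q]! D q (m≤m+n _ _) (≤-trans (s≤s z≤n) (≤-trans (m≤n+m 2 (suc c * budget)) (m≤n+m _ (4 * (D * D)))))) ⟩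
    length (choose M X) * M !               ≤⟨ length-choose M X ⟩
    length X ^ M                            ≤⟨ ^-monoˡ-≤ M X≤ ⟩
    (D * 2 ^ r) ^ M                         ≡⟨ ^-distribʳ-* M D (2 ^ r) ⟩
    D ^ M * (2 ^ r) ^ M                     ∎)
    where
    arrange : ∀ x y → x * (4 * y) ≡ y * (4 * x)
    arrange = solve-∀

  c+1·budget+2≤M : suc c * budget + 2 ≤ M
  c+1·budget+2≤M = ≤-trans (m≤n+m _ (4 * (D * D))) (m≤m+n q q)

  -- For r below the threshold the trivial bound on probabilities suffices.
  factor threshold : ℕ
  factor    = 2 * suc (c * D) * (D ^ c) ^ suc e + 2
  threshold = 4 * c * (4 * slope)

  module Instance (r s : ℕ) (side : Bool → Fin d) (sides-differ : side false ≢ side true)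
    (X : List (Key c s)) (X! : Unique X) where
    open Exploration d c s r side sides-differ X X! (θ r) e L M

    count-rooted-large : 4 * slope ≤ w r → length X ≤ D * 2 ^ r →
                         count (rooted? (depth r)) Ω * (2 ^ r) ^ g ≤ factor * length Ω
    count-rooted-large large X≤ = begin
      count (rooted? k) Ω * R ^ g                                    ≤⟨ *-monoˡ-≤ (R ^ g) split ⟩
      (count bad? Ω + count (surprise? k) Ω) * R ^ g                 ≡⟨ *-distribʳ-+ (R ^ g) (count bad? Ω) _ ⟩
      count bad? Ω * R ^ g + count (surprise? k) Ω * R ^ g           ≤⟨ +-mono-≤ bad-part surprise-part ⟩
      2 * suc (c * D) * (D ^ c) ^ suc e * N + 2 * N                  ≡⟨ *-distribʳ-+ N (2 * suc (c * D) * (D ^ c) ^ suc e) 2 ⟨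
      factor * N                                                     ∎
      where
      open Large r large
      open Counting d c s r side sides-differ X X! (θ r) e L M ≤-refl 1≤ (Q r) (2 ^ w r) (m^n>0 2 (w r)) few-bad (few-good r X X≤)
        using (surprise?; count-surprise; N)
      k = depth r
      R = 2 ^ r
      u = 2 ^ (2 * w r)
      instance
        R≢0 : NonZero R
        R≢0 = m^n≢0 2 r
        θ≢0 : NonZero (θ r)
        θ≢0 = m^n≢0 2 (r ∸ 2 * w r)
      split : count (rooted? k) Ω ≤ count bad? Ω + count (surprise? k) Ω
      split = ≤-trans (∑-mono Ω λ H → ind-≤ (rooted? k H) λ rt → by-cases H rt (bad? H))
                      (≤-reflexive (∑-distrib-+ Ω _ _))
        where
        by-cases : ∀ H → Rooted k H → Dec (Bad H) → 1 ≤ ind (bad? H) + ind (surprise? k H)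
        by-cases H rt (yes bad) = ≤-trans (≤-reflexive (sym (ind-yes (bad? H) bad))) (m≤m+n _ _)
        by-cases H rt (no ¬bad) = ≤-trans (≤-reflexive (sym (ind-yes (surprise? k H) (¬bad , rt)))) (m≤n+m _ _)
      D₁ = D ^ c
      b = D₁ * θ r
      θ≤b : θ r ≤ b
      θ≤b = ≤-trans (≤-reflexive (sym (*-identityˡ (θ r)))) (*-monoˡ-≤ (θ r) (m^n>0 D {{>-nonZero 1≤D}} c))
      dull≤b : length dull ≤ b
      dull≤b = begin
        length dull                   ≤⟨ DullKeys.length-dull c s X X! (θ r) (D * u) X≤Duθ ⟩
        (D * u) ^ c                   ≡⟨ ^-distribʳ-* c D u ⟩
        D₁ * u ^ c                    ≤⟨ *-monoʳ-≤ D₁ u^c≤θ ⟩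
        D₁ * θ r                      ∎
        where
        X≤Duθ : length X ≤ D * u * θ r
        X≤Duθ = ≤-trans X≤ (≤-reflexive (trans (cong (D *_) (trans (sym (θ·2^2w r)) (*-comm (θ r) u))) (sym (*-assoc D u (θ r)))))
        u^c≤θ : u ^ c ≤ θ r
        u^c≤θ = ≤-trans (≤-reflexive (^-*-assoc 2 (2 * w r) c)) (^-monoʳ-≤ 2 (m+n≤o⇒m≤o∸n (2 * w r * c) (begin
          2 * w r * c + 2 * w r           ≤⟨ +-monoʳ-≤ (2 * w r * c) (≤-trans (≤-reflexive (sym (*-identityʳ (2 * w r)))) (*-monoʳ-≤ (2 * w r) (≤-trans (s≤s z≤n) 2≤c))) ⟩
          2 * w r * c + 2 * w r * c       ≡⟨ arrange (w r) c ⟩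
          w r * (4 * c)                   ≤⟨ 4cw≤r r ⟩
          r                               ∎)))
          where
          arrange : ∀ w c → 2 * w * c + 2 * w * c ≡ w * (4 * c)
          arrange = solve-∀
      tests≤ : length tests ≤ 2 * suc (c * D) * R
      tests≤ = begin
        length tests                      ≡⟨ length-tests ⟩
        2 * suc (c * length X)            ≤⟨ *-monoʳ-≤ 2 (s≤s (*-monoʳ-≤ c X≤)) ⟩
        2 * suc (c * (D * R))             ≤⟨ *-monoʳ-≤ 2 (+-monoˡ-≤ _ (m^n>0 2 r)) ⟩
        2 * (R + c * (D * R))             ≡⟨ arrange c D R ⟩
        2 * suc (c * D) * R               ∎
        where
        arrange : ∀ c D R → 2 * (R + c * (D * R)) ≡ 2 * (1 + c * D) * R
        arrange = solve-∀
      R² : R ^ g⁺ ≡ R ^ g * (R * R)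
      R² = trans (^-distribˡ-+-* R g 2) (cong (λ x → R ^ g * (R * x)) (*-identityʳ R))
      bad-part : count bad? Ω * R ^ g ≤ 2 * suc (c * D) * D₁ ^ suc e * N
      bad-part = *-cancelʳ-≤ _ _ (R * R) {{m*n≢0 R R}} (*-cancelʳ-≤ _ _ (R ^ e) {{m^n≢0 R e}} (begin
        count bad? Ω * R ^ g * (R * R) * R ^ e                     ≡⟨ cong (_* R ^ e) (trans (*-assoc (count bad? Ω) _ _) (cong (count bad? Ω *_) (sym R²))) ⟩
        count bad? Ω * R ^ g⁺ * R ^ e                              ≤⟨ *-monoˡ-≤ (R ^ e) (*-monoʳ-≤ (count bad? Ω) R^g⁺≤2^2we) ⟩
        count bad? Ω * u ^ suc e * R ^ e                           ≡⟨ arrange₁ (count bad? Ω) (u ^ suc e) (R ^ e) ⟩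
        u ^ suc e * (count bad? Ω * R ^ e)                         ≤⟨ *-monoʳ-≤ (u ^ suc e) (count-bad b θ≤b dull≤b) ⟩
        u ^ suc e * (length tests * (b ^ suc e * N))               ≤⟨ *-monoʳ-≤ (u ^ suc e) (*-monoˡ-≤ _ tests≤) ⟩
        u ^ suc e * (2 * suc (c * D) * R * (b ^ suc e * N))        ≡⟨ cong (λ x → u ^ suc e * (2 * suc (c * D) * R * (x * N))) (^-distribʳ-* (suc e) D₁ (θ r)) ⟩
        u ^ suc e * (2 * suc (c * D) * R * (D₁ ^ suc e * θ r ^ suc e * N))
                                                                   ≡⟨ arrange₂ (u ^ suc e) (2 * suc (c * D)) R (D₁ ^ suc e) (θ r ^ suc e) N ⟩
        2 * suc (c * D) * D₁ ^ suc e * N * R * (θ r ^ suc e * u ^ suc e)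
                                                                   ≡⟨ cong (2 * suc (c * D) * D₁ ^ suc e * N * R *_) (trans (sym (^-distribʳ-* (suc e) (θ r) u)) (cong (_^ suc e) (θ·2^2w r))) ⟩
        2 * suc (c * D) * D₁ ^ suc e * N * R * (R * R ^ e)         ≡⟨ arrange₃ (2 * suc (c * D) * D₁ ^ suc e * N) R (R ^ e) ⟩
        2 * suc (c * D) * D₁ ^ suc e * N * (R * R) * R ^ e         ∎))
        where
        arrange₁ : ∀ x y z → x * y * z ≡ y * (x * z)
        arrange₁ = solve-∀
        arrange₂ : ∀ u t R x y N → u * (t * R * (x * y * N)) ≡ t * x * N * R * (y * u)
        arrange₂ = solve-∀
        arrange₃ : ∀ x R y → x * R * (R * y) ≡ x * (R * R) * y
        arrange₃ = solve-∀
      surprise-part : count (surprise? k) Ω * R ^ g ≤ 2 * N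
      surprise-part = *-cancelʳ-≤ _ _ R (*-cancelʳ-≤ _ _ R (*-cancelʳ-≤ _ _ y {{m^n≢0 (2 ^ w r) budget {{m^n≢0 2 (w r)}}}} (begin
        S * R ^ g * R * R * y                 ≡⟨ arrange₁ S (R ^ g) R y ⟩
        S * (R ^ g * (R * R) * y)             ≡⟨ cong (λ x → S * (x * y)) R² ⟨
        S * (R ^ g⁺ * y)                      ≡⟨ cong (λ x → S * (x * y)) x≡ ⟨
        S * (2 ^ (g⁺ * r) * y)                ≤⟨ count-surprise k (g⁺ * r) budget (g⁺r≤nodes r) ≤-refl c+1·budget+2≤M ⟩
        R * (N * (y + 2 ^ (g⁺ * r)))          ≤⟨ *-monoʳ-≤ R (*-monoʳ-≤ N (+-monoʳ-≤ y (≤-trans (≤-reflexive x≡) R^g⁺≤β^budget))) ⟩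
        R * (N * (y + y))                     ≡⟨ arrange₂ R N y ⟩
        2 * N * R * 1 * y                     ≤⟨ *-monoˡ-≤ y (*-monoʳ-≤ (2 * N * R) (m^n>0 2 r)) ⟩
        2 * N * R * R * y                     ∎)))
        where
        S = count (surprise? k) Ω
        y = (2 ^ w r) ^ budget
        x≡ : 2 ^ (g⁺ * r) ≡ R ^ g⁺
        x≡ = trans (cong (2 ^_) (*-comm g⁺ r)) (sym (^-*-assoc 2 r g⁺))
        arrange₁ : ∀ S x R y → S * x * R * R * y ≡ S * (x * (R * R) * y)
        arrange₁ = solve-∀
        arrange₂ : ∀ R N y → R * (N * (y + y)) ≡ 2 * N * R * 1 * y
        arrange₂ = solve-∀

    count-rooted : length X ≤ D * 2 ^ r →
                   count (rooted? (depth r)) Ω * (2 ^ r) ^ g ≤ (factor + (2 ^ threshold) ^ g) * length Ω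
    count-rooted X≤ with threshold ≤? r
    ... | yes large = ≤-trans (count-rooted-large 4slope≤w X≤) (*-monoˡ-≤ (length Ω) (m≤m+n factor _))
      where
      4slope≤w : 4 * slope ≤ w r
      4slope≤w = s≤s⁻¹ (*-cancelˡ-< (4 * c) _ _ (≤-<-trans large (r<4c[w+1] r)))
    ... | no small = begin
      count (rooted? (depth r)) Ω * (2 ^ r) ^ g         ≤⟨ *-mono-≤ (count≤length (rooted? (depth r)) Ω) (^-monoˡ-≤ g (^-monoʳ-≤ 2 (<⇒≤ (≰⇒> small)))) ⟩
      length Ω * (2 ^ threshold) ^ g                    ≡⟨ *-comm (length Ω) _ ⟩
      (2 ^ threshold) ^ g * length Ω                    ≤⟨ *-monoˡ-≤ (length Ω) (m≤n+m _ factor) ⟩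
      (factor + (2 ^ threshold) ^ g) * length Ω         ∎

-- Rational and real bounds

toℚᵘ-fromℕ : ∀ k → toℚᵘ (fromℕ k) ℚᵘ.≃ mkℚᵘ (ℤ.+ k) 0
toℚᵘ-fromℕ k = ℚ.toℚᵘ-fromℚᵘ (mkℚᵘ (ℤ.+ k) 0)

fromℕ-+ : ∀ m n → fromℕ (m ℕ.+ n) ≡ fromℕ m ℚ.+ fromℕ n
fromℕ-+ m n = ℚ.toℚᵘ-injective (ℚᵘ.≃-trans (toℚᵘ-fromℕ (m ℕ.+ n)) (ℚᵘ.≃-sym (ℚᵘ.≃-trans (ℚ.toℚᵘ-homo-+ (fromℕ m) (fromℕ n))
  (ℚᵘ.≃-trans (ℚᵘ.+-cong (toℚᵘ-fromℕ m) (toℚᵘ-fromℕ n)) (*≡* (cong (ℤ._* ℤ.+ 1) (cong₂ ℤ._+_ (ℤ.*-identityʳ (ℤ.+ m)) (ℤ.*-identityʳ (ℤ.+ n)))))))))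

fromℕ-* : ∀ m n → fromℕ (m ℕ.* n) ≡ fromℕ m ℚ.* fromℕ n
fromℕ-* m n = ℚ.toℚᵘ-injective (ℚᵘ.≃-trans (toℚᵘ-fromℕ (m ℕ.* n)) (ℚᵘ.≃-sym (ℚᵘ.≃-trans (ℚ.toℚᵘ-homo-* (fromℕ m) (fromℕ n))
  (ℚᵘ.≃-trans (ℚᵘ.*-cong (toℚᵘ-fromℕ m) (toℚᵘ-fromℕ n)) (*≡* (cong (ℤ._* ℤ.+ 1) (sym (ℤ.pos-* m n))))))))

fromℕ-mono-≤ : ∀ {m n} → m ℕ.≤ n → fromℕ m ℚ.≤ fromℕ n
fromℕ-mono-≤ {m} {n} m≤n = ℚ.toℚᵘ-cancel-≤ (ℚᵘ.≤-respˡ-≃ (ℚᵘ.≃-sym (toℚᵘ-fromℕ m)) (ℚᵘ.≤-respʳ-≃ (ℚᵘ.≃-sym (toℚᵘ-fromℕ n))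
  (*≤* (ℤ.*-monoʳ-≤-nonNeg (ℤ.+ 1) (ℤ.+≤+ m≤n)))))

fromℕ-cancel-≤ : ∀ {m n} → fromℕ m ℚ.≤ fromℕ n → m ℕ.≤ n
fromℕ-cancel-≤ {m} {n} le with ℚᵘ.≤-respˡ-≃ (toℚᵘ-fromℕ m) (ℚᵘ.≤-respʳ-≃ (toℚᵘ-fromℕ n) (ℚ.toℚᵘ-mono-≤ le))
... | *≤* le′ = ℤ.drop‿+≤+ (subst₂ ℤ._≤_ (ℤ.*-identityʳ (ℤ.+ m)) (ℤ.*-identityʳ (ℤ.+ n)) le′)

/-* : ∀ a b .{{_ : ℕ.NonZero b}} → (ℤ.+ a ℚ./ b) ℚ.* fromℕ b ≡ fromℕ a
/-* a (suc b) = ℚ.toℚᵘ-injective (ℚᵘ.≃-trans (ℚ.toℚᵘ-homo-* (ℤ.+ a ℚ./ suc b) (fromℕ (suc b)))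
  (ℚᵘ.≃-trans (ℚᵘ.*-cong (ℚ.toℚᵘ-fromℚᵘ (mkℚᵘ (ℤ.+ a) b)) (toℚᵘ-fromℕ (suc b)))
    (ℚᵘ.≃-trans (*≡* (trans (ℤ.*-identityʳ (ℤ.+ a ℤ.* ℤ.+ suc b)) (cong (λ k → ℤ.+ a ℤ.* ℤ.+ k) (sym (ℕ.*-identityʳ (suc b))))))
      (ℚᵘ.≃-sym (toℚᵘ-fromℕ a)))))

0≤fromℕ : ∀ k → 0ℚ ℚ.≤ fromℕ k
0≤fromℕ k = fromℕ-mono-≤ {0} {k} ℕ.z≤n

0<fromℕ : ∀ k .{{_ : ℕ.NonZero k}} → 0ℚ ℚ.< fromℕ k
0<fromℕ (suc k) = ℚ.<-≤-trans (ℚ.positive⁻¹ 1ℚ) (fromℕ-mono-≤ {1} {suc k} (ℕ.s≤s ℕ.z≤n))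

fromℕ-nonNeg : ∀ k → ℚ.NonNegative (fromℕ k)
fromℕ-nonNeg k = ℚ.nonNegative (0≤fromℕ k)

fromℕ-pos : ∀ k .{{_ : ℕ.NonZero k}} → ℚ.Positive (fromℕ k)
fromℕ-pos k = ℚ.positive (0<fromℕ k)

fromℕ≤/ : ∀ {k a b} .{{_ : ℕ.NonZero b}} → k ℕ.* b ℕ.≤ a → fromℕ k ℚ.≤ ℤ.+ a ℚ./ b
fromℕ≤/ {k} {a} {b} kb≤a = ℚ.*-cancelʳ-≤-pos (fromℕ b) {{fromℕ-pos b}} (begin
  fromℕ k ℚ.* fromℕ b           ≡⟨ fromℕ-* k b ⟨
  fromℕ (k ℕ.* b)               ≤⟨ fromℕ-mono-≤ kb≤a ⟩
  fromℕ a                       ≡⟨ /-* a b ⟨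
  (ℤ.+ a ℚ./ b) ℚ.* fromℕ b       ∎)
  where open ℚ.≤-Reasoning

/<fromℕ⇒≤ : ∀ {a b k} .{{_ : ℕ.NonZero b}} → ℤ.+ a ℚ./ b ℚ.< fromℕ k → a ℕ.≤ k ℕ.* b
/<fromℕ⇒≤ {a} {b} {k} lt = fromℕ-cancel-≤ (begin
  fromℕ a                       ≡⟨ /-* a b ⟨
  (ℤ.+ a ℚ./ b) ℚ.* fromℕ b       ≤⟨ ℚ.*-monoʳ-≤-nonNeg (fromℕ b) {{fromℕ-nonNeg b}} (ℚ.<⇒≤ lt) ⟩
  fromℕ k ℚ.* fromℕ b           ≡⟨ fromℕ-* k b ⟨
  fromℕ (k ℕ.* b)               ∎)
  where open ℚ.≤-Reasoning

archimedean : ∀ q → ∃[ k ] q ℚ.< fromℕ (suc k)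
archimedean q@(ℚ.mkℚ n d _) = ℤ.∣ n ∣ , ℚ.toℚᵘ-cancel-< (ℚᵘ.<-respʳ-≃ (ℚᵘ.≃-sym (toℚᵘ-fromℕ (suc ℤ.∣ n ∣)))
  (ℚᵘ.*<* (ℤ.≤-<-trans (ℤ.≤-trans (ℤ.≤-reflexive (ℤ.*-identityʳ n)) (ℤ.≤-trans (i≤∣i∣ n) bound))
    (ℤ.+<+ (ℕ.n<1+n _)))))
  where
  i≤∣i∣ : ∀ i → i ℤ.≤ ℤ.+ ℤ.∣ i ∣
  i≤∣i∣ (ℤ.+ _)      = ℤ.≤-refl
  i≤∣i∣ ℤ.-[1+ _ ] = ℤ.-≤+
  bound : ℤ.+ ℤ.∣ n ∣ ℤ.≤ ℤ.+ (d ℕ.+ ℤ.∣ n ∣ ℕ.* suc d)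
  bound = ℤ.+≤+ (ℕ.≤-trans (ℕ.m≤m*n ℤ.∣ n ∣ (suc d)) (ℕ.m≤n+m _ d))

^-distribʳ-*ℚ : ∀ n x y → (x ℚ.* y) ^ℚ n ≡ x ^ℚ n ℚ.* y ^ℚ n
^-distribʳ-*ℚ zero    x y = refl
^-distribʳ-*ℚ (suc n) x y = trans (cong (x ℚ.* y ℚ.*_) (^-distribʳ-*ℚ n x y)) (interchange x y (x ^ℚ n) (y ^ℚ n))
  where
  open import Algebra.Properties.CommutativeSemigroup (CommutativeMonoid.commutativeSemigroup ℚ.*-1-commutativeMonoid)
    using (interchange)

fromℕ-^ : ∀ m n → fromℕ (m ℕ.^ n) ≡ fromℕ m ^ℚ n
fromℕ-^ m zero    = refl
fromℕ-^ m (suc n) = trans (fromℕ-* m (m ℕ.^ n)) (cong (fromℕ m ℚ.*_) (fromℕ-^ m n))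

0≤^ : ∀ {x} n → 0ℚ ℚ.≤ x → 0ℚ ℚ.≤ x ^ℚ n
0≤^ zero    0≤x = ℚ.nonNegative⁻¹ 1ℚ
0≤^ {x} (suc n) 0≤x = ℚ.nonNegative⁻¹ (x ℚ.* x ^ℚ n) {{ℚ.nonNeg*nonNeg⇒nonNeg x {{ℚ.nonNegative 0≤x}} (x ^ℚ n) {{ℚ.nonNegative (0≤^ n 0≤x)}}}}

^-mono-≤ : ∀ {x y} n → 0ℚ ℚ.≤ x → x ℚ.≤ y → x ^ℚ n ℚ.≤ y ^ℚ n
^-mono-≤ zero    0≤x x≤y = ℚ.≤-refl
^-mono-≤ {x} {y} (suc n) 0≤x x≤y = ℚ.≤-trans
  (ℚ.*-monoʳ-≤-nonNeg (x ^ℚ n) {{ℚ.nonNegative (0≤^ n 0≤x)}} x≤y)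
  (ℚ.*-monoˡ-≤-nonNeg y {{ℚ.nonNegative (ℚ.≤-trans 0≤x x≤y)}} (^-mono-≤ n 0≤x x≤y))

1^n : ∀ n → 1ℚ ^ℚ n ≡ 1ℚ
1^n zero    = refl
1^n (suc n) = trans (ℚ.*-identityˡ (1ℚ ^ℚ n)) (1^n n)

^-cancel-≤ : ∀ {u n b a} → u ℕ.^ b ℕ.≤ 2 ℕ.^ a → 2 ℕ.^ n ℕ.≤ u → n ℕ.* b ℕ.≤ a
^-cancel-≤ {u} {n} {b} {a} u^b≤ 2^n≤u = ℕ.≮⇒≥ λ a<nb → ℕ.<-irrefl refl (ℕ.<-≤-trans (ℕ.^-monoʳ-< 2 ℕ.≤-refl a<nb)
  (ℕ.≤-trans (ℕ.≤-reflexive (sym (ℕ.^-*-assoc 2 n b))) (ℕ.≤-trans (ℕ.^-monoˡ-≤ b 2^n≤u) u^b≤)))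

above⇒positive-bound : ∀ (x : ℝ) → ∃[ k ] ∃[ q ] ℝ.Above x q × q ℚ.< fromℕ (suc k)
above⇒positive-bound x = let (q , above) = ℝ.above-inhabited x
                             (k , q<)    = archimedean q
                         in k , q , above , q<

below<above : ∀ (x : ℝ) {p q} → ℝ.Below x p → ℝ.Above x q → p ℚ.< q
below<above x {p} {q} below above with ℚ.<-cmp p q
... | tri< p<q _ _    = p<q
... | tri≈ _ refl _   = ⊥-elim (ℝ.disjoint x (below , above))
... | tri> _ _ q<p    = ⊥-elim (ℝ.disjoint x (below , ℝ.above-upper x q<p above))

-- The hypothesis bounds `m` by every rational above `n` times `C`, and `n * k` is one of them.
size-bound : ∀ (C : ℝ) {k q m n} → ℝ.Above C q → q ℚ.< fromℕ k → 1 ℕ.≤ n →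
             fromℕ m ≤ᵘ n · upper C → m ℕ.≤ n ℕ.* k
size-bound C {k} {q} {m} {n} above q<k 1≤n m≤ = fromℕ-cancel-≤ (m≤ (fromℕ (n ℕ.* k))
  (q , above , subst (fromℕ n ℚ.* q ℚ.<_) (sym (fromℕ-* n k)) (ℚ.*-monoʳ-<-pos (fromℕ n) {{fromℕ-pos n {{ℕ.>-nonZero 1≤n}}}} q<k)))

-- n ^ -γ ≥ n ^ -g for a natural number g ≥ γ.
^-lower : ∀ {n γ p q g} → ℝ.Above γ q → q ℚ.< fromℕ g → 1 ℕ.≤ n → (n ^- γ) p → 1ℚ ℚ.≤ p ℚ.* fromℕ (n ℕ.^ g)
^-lower {n} {γ} {p} {q} {g} above q<g 1≤n (0<p , a , b′ , below , 1<) = ℚ.≮⇒≥ λ x<1 → ℚ.<-irrefl refl (begin-strict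
  1ℚ                                         <⟨ 1< ⟩
  p ^ℚ b ℚ.* fromℕ n ^ℚ a                      ≡⟨ cong (p ^ℚ b ℚ.*_) (fromℕ-^ n a) ⟨
  p ^ℚ b ℚ.* fromℕ (n ℕ.^ a)                  ≤⟨ ℚ.*-monoˡ-≤-nonNeg (p ^ℚ b) {{ℚ.nonNegative (0≤^ b (ℚ.<⇒≤ 0<p))}} (fromℕ-mono-≤ (ℕ.^-monoʳ-≤ n {{ℕ.>-nonZero 1≤n}} a≤gb)) ⟩
  p ^ℚ b ℚ.* fromℕ (n ℕ.^ (g ℕ.* b))          ≡⟨ cong (λ k → p ^ℚ b ℚ.* fromℕ k) (ℕ.^-*-assoc n g b) ⟨
  p ^ℚ b ℚ.* fromℕ ((n ℕ.^ g) ℕ.^ b)          ≡⟨ cong (p ^ℚ b ℚ.*_) (fromℕ-^ (n ℕ.^ g) b) ⟩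
  p ^ℚ b ℚ.* fromℕ (n ℕ.^ g) ^ℚ b              ≡⟨ ^-distribʳ-*ℚ b p (fromℕ (n ℕ.^ g)) ⟨
  x ^ℚ b                                      ≤⟨ ^-mono-≤ b 0≤x (ℚ.<⇒≤ x<1) ⟩
  1ℚ ^ℚ b                                     ≡⟨ 1^n b ⟩
  1ℚ                                         ∎)
  where
  open ℚ.≤-Reasoning
  b = suc b′
  x = p ℚ.* fromℕ (n ℕ.^ g)
  a≤gb : a ℕ.≤ g ℕ.* b
  a≤gb = /<fromℕ⇒≤ {a} {b} {g} (ℚ.<-trans (below<above γ below above) q<g)
  0≤x : 0ℚ ℚ.≤ x
  0≤x = ℚ.nonNegative⁻¹ x {{ℚ.nonNeg*nonNeg⇒nonNeg p {{ℚ.nonNegative (ℚ.<⇒≤ 0<p)}} (fromℕ (n ℕ.^ g)) {{fromℕ-nonNeg (n ℕ.^ g)}}}}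

log₂-lower : ∀ {n m y} → 2 ℕ.^ m ℕ.≤ n → log₂ (natural n) y → fromℕ m ℚ.≤ y
log₂-lower {n} {m} 2^m≤n (y′ , n<y′ , a , b′ , a/b≤y , y′^b≤2^a) =
  ℚ.≤-trans (fromℕ≤/ {k = m} {a} (^-cancel-≤ {n} {m} {suc b′} {a} n^b≤2^a 2^m≤n)) a/b≤y
  where
  n^b≤2^a : n ℕ.^ suc b′ ℕ.≤ 2 ℕ.^ a
  n^b≤2^a = fromℕ-cancel-≤ (ℚ.≤-trans (ℚ.≤-reflexive (fromℕ-^ n (suc b′)))
    (ℚ.≤-trans (^-mono-≤ (suc b′) (0≤fromℕ n) (ℚ.<⇒≤ n<y′)) (ℚ.≤-trans y′^b≤2^a (ℚ.≤-reflexive (sym (fromℕ-^ 2 a))))))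

loglog-lower : ∀ {n m l t} → 4 ℕ.≤ n → 2 ℕ.^ m ℕ.≤ n → 2 ℕ.^ l ℕ.≤ m → log₂ (log₂ (natural n)) t →
               fromℕ 1 ℚ.≤ t × fromℕ l ℚ.≤ t
loglog-lower {n} {m} {l} {t} 4≤n 2^m≤n 2^l≤m (y , log-y , a , b′ , a/b≤t , y^b≤2^a) =
  lower 2 1 4≤n ℕ.≤-refl , lower m l 2^m≤n 2^l≤m
  where
  lower : ∀ m l → 2 ℕ.^ m ℕ.≤ n → 2 ℕ.^ l ℕ.≤ m → fromℕ l ℚ.≤ t
  lower m l 2^m≤n 2^l≤m = ℚ.≤-trans (fromℕ≤/ {k = l} {a} (^-cancel-≤ {m} {l} {suc b′} {a} m^b≤2^a 2^l≤m)) a/b≤t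
    where
    m^b≤2^a : m ℕ.^ suc b′ ℕ.≤ 2 ℕ.^ a
    m^b≤2^a = fromℕ-cancel-≤ (ℚ.≤-trans (ℚ.≤-reflexive (fromℕ-^ m (suc b′)))
      (ℚ.≤-trans (^-mono-≤ (suc b′) (0≤fromℕ m) (log₂-lower {n} {m} 2^m≤n log-y)) (ℚ.≤-trans y^b≤2^a (ℚ.≤-reflexive (sym (fromℕ-^ 2 a))))))

-- The additive constant `h` is absorbed into the factor `suc h`, because `4 ≤ n` makes the iterated
-- logarithm at least 1.
loglog-bound : ∀ {n m l h L k} → 4 ℕ.≤ n → 2 ℕ.^ m ℕ.≤ n → 2 ℕ.^ l ℕ.≤ m → k ℕ.≤ (l ℕ.+ h) ℕ.* L →
               fromℕ k ≤ᵘ (suc h ℕ.* L) · log₂ (log₂ (natural n))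
loglog-bound {n} {m} {l} {h} {L} {k} 4≤n 2^m≤n 2^l≤m k≤ q (t , loglog , Kt<q) = ℚ.≤-trans (begin
  fromℕ k                                              ≤⟨ fromℕ-mono-≤ k≤ ⟩
  fromℕ ((l ℕ.+ h) ℕ.* L)                              ≡⟨ fromℕ-* (l ℕ.+ h) L ⟩
  fromℕ (l ℕ.+ h) ℚ.* fromℕ L                          ≤⟨ ℚ.*-monoʳ-≤-nonNeg (fromℕ L) {{fromℕ-nonNeg L}} l+h≤ ⟩
  fromℕ (suc h) ℚ.* t ℚ.* fromℕ L                      ≡⟨ ℚ.*-assoc (fromℕ (suc h)) t (fromℕ L) ⟩
  fromℕ (suc h) ℚ.* (t ℚ.* fromℕ L)                    ≡⟨ cong (fromℕ (suc h) ℚ.*_) (ℚ.*-comm t (fromℕ L)) ⟩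
  fromℕ (suc h) ℚ.* (fromℕ L ℚ.* t)                    ≡⟨ ℚ.*-assoc (fromℕ (suc h)) (fromℕ L) t ⟨
  fromℕ (suc h) ℚ.* fromℕ L ℚ.* t                      ≡⟨ cong (ℚ._* t) (fromℕ-* (suc h) L) ⟨
  fromℕ (suc h ℕ.* L) ℚ.* t                            ∎) (ℚ.<⇒≤ Kt<q)
  where
  open ℚ.≤-Reasoning
  1≤t = proj₁ (loglog-lower {n} {m} {l} 4≤n 2^m≤n 2^l≤m loglog)
  l≤t = proj₂ (loglog-lower {n} {m} {l} 4≤n 2^m≤n 2^l≤m loglog)
  l+h≤ : fromℕ (l ℕ.+ h) ℚ.≤ fromℕ (suc h) ℚ.* t
  l+h≤ = begin
    fromℕ (l ℕ.+ h)                     ≡⟨ fromℕ-+ l h ⟩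
    fromℕ l ℚ.+ fromℕ h                 ≤⟨ ℚ.+-mono-≤ l≤t (ℚ.≤-trans (ℚ.≤-reflexive (sym (ℚ.*-identityʳ (fromℕ h)))) (ℚ.*-monoˡ-≤-nonNeg (fromℕ h) {{fromℕ-nonNeg h}} 1≤t)) ⟩
    t ℚ.+ fromℕ h ℚ.* t                 ≡⟨ cong (ℚ._+ fromℕ h ℚ.* t) (ℚ.*-identityˡ t) ⟨
    1ℚ ℚ.* t ℚ.+ fromℕ h ℚ.* t          ≡⟨ ℚ.*-distribʳ-+ t 1ℚ (fromℕ h) ⟨
    (1ℚ ℚ.+ fromℕ h) ℚ.* t              ≡⟨ cong (ℚ._* t) (fromℕ-+ 1 h) ⟨
    fromℕ (suc h) ℚ.* t                 ∎

-- N outcomes, of which f fail and t succeed.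
success-probability : ∀ {n γ g q₀ A f t N} .{{_ : ℕ.NonZero N}} → ℝ.Above γ q₀ → q₀ ℚ.< fromℕ g → 1 ℕ.≤ n →
  f ℕ.+ t ≡ N → f ℕ.* n ℕ.^ g ℕ.≤ A ℕ.* N → ∀ q → (A · (n ^- γ)) q → 1ℚ ℚ.- q ℚ.≤ ℤ.+ t ℚ./ N
success-probability {n} {γ} {g} {q₀} {A} {f} {t} {N} above q₀<g 1≤n f+t≡N few q (p , n^-γ<p , Ap<q) =
  ℚ.*-cancelʳ-≤-pos (fromℕ N) {{fromℕ-pos N}} (begin
    (1ℚ ℚ.- q) ℚ.* fromℕ N                            ≡⟨ ℚ.*-distribʳ-+ (fromℕ N) 1ℚ (ℚ.- q) ⟩
    1ℚ ℚ.* fromℕ N ℚ.+ (ℚ.- q) ℚ.* fromℕ N            ≡⟨ cong₂ ℚ._+_ (ℚ.*-identityˡ (fromℕ N)) (sym (ℚ.neg-distribˡ-* q (fromℕ N))) ⟩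
    fromℕ N ℚ.- q ℚ.* fromℕ N                         ≤⟨ ℚ.+-monoʳ-≤ (fromℕ N) (ℚ.neg-antimono-≤ f≤qN) ⟩
    fromℕ N ℚ.- fromℕ f                               ≡⟨ cong (ℚ._- fromℕ f) (trans (cong fromℕ (trans (sym f+t≡N) (ℕ.+-comm f t))) (fromℕ-+ t f)) ⟩
    fromℕ t ℚ.+ fromℕ f ℚ.- fromℕ f                   ≡⟨ ℚ.+-assoc (fromℕ t) (fromℕ f) (ℚ.- fromℕ f) ⟩
    fromℕ t ℚ.+ (fromℕ f ℚ.- fromℕ f)                 ≡⟨ cong (fromℕ t ℚ.+_) (ℚ.+-inverseʳ (fromℕ f)) ⟩
    fromℕ t ℚ.+ 0ℚ                                    ≡⟨ ℚ.+-identityʳ (fromℕ t) ⟩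
    fromℕ t                                           ≡⟨ /-* t N ⟨
    (ℤ.+ t ℚ./ N) ℚ.* fromℕ N                           ∎)
  where
  open ℚ.≤-Reasoning
  0<p = proj₁ n^-γ<p
  f≤qN : fromℕ f ℚ.≤ q ℚ.* fromℕ N
  f≤qN = begin
    fromℕ f                                           ≡⟨ ℚ.*-identityʳ (fromℕ f) ⟨
    fromℕ f ℚ.* 1ℚ                                    ≤⟨ ℚ.*-monoˡ-≤-nonNeg (fromℕ f) {{fromℕ-nonNeg f}} (^-lower {n} {γ} {p} {q₀} {g} above q₀<g 1≤n n^-γ<p) ⟩
    fromℕ f ℚ.* (p ℚ.* fromℕ (n ℕ.^ g))               ≡⟨ cong (fromℕ f ℚ.*_) (ℚ.*-comm p (fromℕ (n ℕ.^ g))) ⟩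
    fromℕ f ℚ.* (fromℕ (n ℕ.^ g) ℚ.* p)               ≡⟨ ℚ.*-assoc (fromℕ f) (fromℕ (n ℕ.^ g)) p ⟨
    fromℕ f ℚ.* fromℕ (n ℕ.^ g) ℚ.* p                 ≡⟨ cong (ℚ._* p) (fromℕ-* f (n ℕ.^ g)) ⟨
    fromℕ (f ℕ.* n ℕ.^ g) ℚ.* p                       ≤⟨ ℚ.*-monoʳ-≤-nonNeg p {{ℚ.nonNegative (ℚ.<⇒≤ 0<p)}} (fromℕ-mono-≤ few) ⟩
    fromℕ (A ℕ.* N) ℚ.* p                             ≡⟨ cong (ℚ._* p) (trans (cong fromℕ (ℕ.*-comm A N)) (fromℕ-* N A)) ⟩
    fromℕ N ℚ.* fromℕ A ℚ.* p                         ≡⟨ ℚ.*-assoc (fromℕ N) (fromℕ A) p ⟩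
    fromℕ N ℚ.* (fromℕ A ℚ.* p)                       ≤⟨ ℚ.*-monoˡ-≤-nonNeg (fromℕ N) {{fromℕ-nonNeg N}} (ℚ.<⇒≤ Ap<q) ⟩
    fromℕ N ℚ.* q                                     ≡⟨ ℚ.*-comm (fromℕ N) q ⟩
    q ℚ.* fromℕ N                                     ∎

-- From the hash graph to the maximum load

count-+-reject : ∀ {A : Set} {P : A → Set} (P? : Decidable P) xs →
                 count P? xs + length (filterᵇ (λ x → not (does (P? x))) xs) ≡ length xs
count-+-reject P? []       = refl
count-+-reject P? (x ∷ xs) with does (P? x)
... | true  = cong suc (count-+-reject P? xs)
... | false = trans (+-suc _ _) (cong suc (count-+-reject P? xs))

twoTables : ∀ {d} → Bool → Fin (2 + d)
twoTables false = zero
twoTables true  = suc zero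

record LikelyBound (d c s r g : ℕ) (X : List (Key c s)) (L h F : ℕ) : Set where
  constructor likelyBound
  field
    S          : Tabulations d c s r → Bool
    failures   : ℕ
    maxLoad-≤  : ∀ H → T (S H) → ∀ bs → Allocation H X bs → maxLoad bs ≤ (proj₁ (floor-log r) + h) * L
    partition  : failures + length (filterᵇ S (allTabulations d c s r)) ≡ length (allTabulations d c s r)
    failures-≤ : failures * (2 ^ r) ^ g ≤ F * length (allTabulations d c s r)

module Tables (d′ c D g : ℕ) .{{_ : NonZero c}} (2≤c : 2 ≤ c) (1≤D : 1 ≤ D) where
  d = 2 + d′
  open Parameters d c D g 2≤c 1≤D public

  likely-bound : ∀ r s X → Unique X → length X ≤ D * 2 ^ r →
                 LikelyBound d c s r g X L (suc (suc g⁺)) (factor + (2 ^ threshold) ^ g)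
  likely-bound r s X X! size = likelyBound (λ H → not (does (rooted? k H))) (count (rooted? k) Ω)
    correct (count-+-reject (rooted? k) Ω) (Instance.count-rooted r s twoTables (λ ()) X X! size)
    where
    open Exploration d c s r twoTables (λ ()) X X! (θ r) e L M
    k = depth r
    poor : ∀ H → T (not (does (rooted? k H))) → ¬ Rooted k H
    poor H ok rooted with rooted? k H
    ... | no ¬rooted = ¬rooted rooted
    correct : ∀ H → T (not (does (rooted? k H))) → ∀ bs → Allocation H X bs →
              maxLoad bs ≤ (proj₁ (floor-log r) + suc (suc g⁺)) * L
    correct H ok bs al = ≤-trans
      -- `Rooted k` speaks of depth `suc k`, the root included; hence the second `suc` in
      -- `suc (suc g⁺)`.
      (Allocations.maxLoad-bound d c s r twoTables (λ ()) X X! (θ r) e L M H (suc k)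
         (λ x∈ rich-x → poor H ok (lose x∈ rich-x)) al)
      (≤-reflexive (cong (_* L) (sym (+-suc (proj₁ (floor-log r)) (suc g⁺)))))

-- Passing from `2 ^ r` to `n = d * 2 ^ r` costs a factor `d` in the number of keys per hash value
-- and `d ^ g` in `A`. The reals enter only through the natural numbers `C₀` and `g` above them.
conclude : ∀ d c (C γ : ℝ) C₀ g {qC qγ} → 2 ≤ d → ℝ.Above C qC → qC ℚ.< fromℕ C₀ → ℝ.Above γ qγ → qγ ℚ.< fromℕ g →
  ∀ L h F → (∀ r s X → Unique X → length X ≤ d * C₀ * 2 ^ r → LikelyBound d c s r g X L h F) →
  Σ[ K ∈ ℕ ] Σ[ A ∈ ℕ ]
  ((n r : ℕ) → 4 ≤ n → n ≡ d * 2 ^ r → (s : ℕ) (X : List (Key c s)) → Unique X →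
   fromℕ (length X) ≤ᵘ n · upper C →
   WithProbability≥1- (A · (n ^- γ)) ∶ λ (H : Tabulations d c s r) →
   ∀ bs → Allocation H X bs →
   fromℕ (maxLoad bs) ≤ᵘ K · log₂ (log₂ (natural n)))
conclude d c C γ C₀ g 2≤d aboveC C<C₀ aboveγ γ<g L h F likely = suc h * L , d ^ g * F , λ n r 4≤n n≡ s X X! X≤ →
  let
    open LikelyBound (likely r s X X! (size n r X 4≤n n≡ X≤))
    few = begin
      failures * n ^ g                                       ≡⟨ cong (λ m → failures * m ^ g) n≡ ⟩
      failures * (d * 2 ^ r) ^ g                             ≡⟨ cong (failures *_) (^-distribʳ-* g d (2 ^ r)) ⟩
      failures * (d ^ g * (2 ^ r) ^ g)                       ≡⟨ x∙yz≈y∙xz failures (d ^ g) ((2 ^ r) ^ g) ⟩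
      d ^ g * (failures * (2 ^ r) ^ g)                       ≤⟨ *-monoʳ-≤ (d ^ g) failures-≤ ⟩
      d ^ g * (F * length (allTabulations d c s r))          ≡⟨ *-assoc (d ^ g) F _ ⟨
      d ^ g * F * length (allTabulations d c s r)            ∎
  in
  S ,
  (λ H ok bs al → loglog-bound {n} {suc r} {proj₁ (floor-log r)} {h} {L} {maxLoad bs} 4≤n
     -- By `2 ≤ d`, `n` is at least `2 ^ suc r`, and `suc r` is the number whose logarithm
     -- `floor-log r` takes.
     (≤-trans (*-monoˡ-≤ (2 ^ r) 2≤d) (≤-reflexive (sym n≡)))
     (proj₁ (proj₂ (floor-log r))) (maxLoad-≤ H ok bs al)) ,
  success-probability {n} {γ} {g} {A = d ^ g * F} {f = failures} {{allTabulations-nonZero d c s r}}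
    aboveγ γ<g (≤-trans (s≤s z≤n) 4≤n) partition few
  where
  open ≤-Reasoning
  size : ∀ n r {s} (X : List (Key c s)) → 4 ≤ n → n ≡ d * 2 ^ r → fromℕ (length X) ≤ᵘ n · upper C →
         length X ≤ d * C₀ * 2 ^ r
  size n r X 4≤n n≡ X≤ = begin
    length X                    ≤⟨ size-bound C aboveC C<C₀ (≤-trans (s≤s z≤n) 4≤n) X≤ ⟩
    n * C₀                      ≡⟨ cong (_* C₀) n≡ ⟩
    d * 2 ^ r * C₀              ≡⟨ xy∙z≈xz∙y d (2 ^ r) C₀ ⟩
    d * C₀ * 2 ^ r              ∎

mainTheorem3 : (d c : ℕ) → 2 ≤ d → 2 ≤ c →
    (C γ : ℝ) → Positive C → Positive γ →
    Σ[ K ∈ ℕ ] Σ[ A ∈ ℕ ]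
    ((n r : ℕ) → 4 ≤ n → n ≡ d * 2 ^ r →
    (s : ℕ) (X : List (Key c s)) → Unique X →
    fromℕ (length X) ≤ᵘ n · upper C →
    WithProbability≥1- (A · (n ^- γ)) ∶ λ (H : Tabulations d c s r) →
    ∀ bs → Allocation H X bs →
    fromℕ (maxLoad bs) ≤ᵘ K · log₂ (log₂ (natural n)))
mainTheorem3 (suc zero) c (s≤s ())
mainTheorem3 d@(suc (suc d′)) c 2≤d 2≤c C γ _ _ =
  let (C₀ , _ , aboveC , C<C₀) = above⇒positive-bound C
      (g , _ , aboveγ , γ<g)   = above⇒positive-bound γ
  in conclude d c C γ (suc C₀) (suc g) 2≤d aboveC C<C₀ aboveγ γ<g _ _ _
       (Tables.likely-bound d′ c (d * suc C₀) (suc g) {{>-nonZero (≤-trans (s≤s z≤n) 2≤c)}} 2≤c (s≤s z≤n))
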